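{- Let $n\ge 1$, $\ell\ge 0$ and let $\boldsymbol\lambda:\mathscr C_n\to\mathbb S_\ell$ be a Fomin field of interlacing signatures of length $\ell$ on the cylindrical lattice $\mathscr C_n$. Then there exist an integer partition $\mu=(\mu_1\ge\dots\ge\mu_{\ell'}>0)$ with $\ell'\le\ell$ and a time $t^*>0$ such that for all integers $t\ge t^*$ and all $i\in\{0,\dots,n\}$ $$\boldsymbol\lambda(t+n,i)=\boldsymbol\lambda(t,i)+(\mu_1,\dots,\mu_{\ell'},0,\dots,0),\qquad \boldsymbol\lambda(-t-n,i)=\boldsymbol\lambda(-t,i)-(0,\dots,0,\mu_{\ell'},\dots,\mu_1),$$ where the added vectors have $\ell$ entries and addition is entrywise.
   Context: Signatures. A signature of length $\ell\ge 0$ is a sequence of integers $\lambda=(\lambda_1\ge\dots\ge\lambda_\ell)$; $\mathbb S_\ell$ is the set of these. The conjugate of $\lambda$ is the sequence $\lambda'=(\lambda'_x)_{x\in\mathbb Z}$, $\lambda'_x=\#\{j:\lambda_j\ge x\}$; it determines $\lambda$. For $\kappa,\mu\in\mathbb S_\ell$ write $\kappa\preceq\mu$ if $\mu_1\ge\kappa_1\ge\mu_2\ge\kappa_2\ge\dots\ge\mu_\ell\ge\kappa_\ell$ (equivalently $\mu'_x-\kappa'_x\in\{0,1\}$ for all $x$). Fomin growth operator. Let $\kappa,\mu,\lambda\in\mathbb S_\ell$ with $\kappa\preceq\mu$ and $\kappa\preceq\lambda$. Put $a_x=\mu'_x-\kappa'_x$, $b_x=\lambda'_x-\kappa'_x$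 (finitely supported, in $\{0,1\}$) and define $(c_x)_{x\in\mathbb Z}$ by $c_x=\max\{0,a_x+b_x+c_{x-1}-1\}$ with $c_x=0$ for $x$ sufficiently negative. Then $\overline{\mathsf F}(\kappa,\mu,\lambda)=\nu$ is the signature in $\mathbb S_\ell$ with $\nu'_x=\mu'_x+\lambda'_x-\kappa'_x+c_{x-1}-c_x$ for all $x\in\mathbb Z$ (it satisfies $\mu\preceq\nu$, $\lambda\preceq\nu$). Cylinder and Fomin fields. $\mathscr C_n=\mathbb Z^2/\sim$ where $(x,y)\sim(x+kn,y-kn)$ for $k\in\mathbb Z$; $\mathbf e_1=(1,0)$, $\mathbf e_2=(0,1)$. A Fomin field of length $\ell$ is a map $\boldsymbol\lambda:\mathscr C_n\to\mathbb S_\ell$ with $\boldsymbol\lambda(p)\preceq\boldsymbol\lambda(p+\mathbf e_i)$ for $i=1,2$ and $\boldsymbol\lambda(p+\mathbf e_1+\mathbf e_2)=\overline{\mathsf F}(\boldsymbol\lambda(p),\boldsymbol\lambda(p+\mathbf e_1),\boldsymbol\lambda(p+\mathbf e_2))$ for all $p\in\mathscr C_n$. -}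

module Defs where

open import Data.Nat.Base as ℕ using (ℕ; suc)
open import Data.Integer.Base using (ℤ; +_; 0ℤ; 1ℤ; _+_; _-_; -_; _*_; _≤_; _≥_; _⊔_)
open import Data.Integer.Properties using (_≤?_)
open import Data.Integer.Tactic.RingSolver using (solve-∀)
open import Data.Fin.Base using (Fin; toℕ)
open import Data.Vec.Base using (Vec; lookup; count; map; padRight; reverse; zipWith)
open import Data.Vec.Relation.Unary.All using (All)
open import Data.Vec.Relation.Unary.Linked using (Linked)
open import Data.Product.Base using (_×_; _,_; Σ-syntax; ∃-syntax)
open import Function.Bundles using (Func)
open import Level using (0ℓ)
open import Relation.Binary.Bundles using (Setoid)
import Relation.Binary.Construct.On as On
open import Relation.Binary.PropositionalEquality
  using (_≡_; refl; setoid)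

record Signature (ℓ : ℕ) : Set where
  field
    entries    : Vec ℤ ℓ
    decreasing : Linked _≥_ entries

open Signature public

-- Equality of signatures is equality of entries; the proofs of
-- monotonicity are ignored.
Signatures : ℕ → Setoid 0ℓ 0ℓ
Signatures ℓ = On.setoid (setoid (Vec ℤ ℓ)) (entries {ℓ})

conj : ∀ {ℓ} → Signature ℓ → ℤ → ℤ
conj κ x = + count (x ≤?_) (entries κ)

infix 4 _⪯_

-- The two components are κ_j ≤ μ_j and μ_{j+1} ≤ κ_j.
_⪯_ : ∀ {ℓ} → Signature ℓ → Signature ℓ → Set
_⪯_ {ℓ} κ μ =
    (∀ (j : Fin ℓ) → lookup (entries κ) j ≤ lookup (entries μ) j)
  × (∀ (i j : Fin ℓ) → toℕ j ≡ suc (toℕ i) →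
       lookup (entries μ) j ≤ lookup (entries κ) i)

-- The sequence c attached to κ, μ, lam.  It is unique: c vanishes far to the
-- left, and the recursion then determines the remaining values.
record IsCarrier {ℓ} (κ μ lam : Signature ℓ) (c : ℤ → ℤ) : Set where
  field
    recursion      : ∀ x → c x ≡ 0ℤ ⊔ ((conj μ x - conj κ x)
                                      + (conj lam x - conj κ x)
                                      + c (x - 1ℤ) - 1ℤ)
    vanishesAtLeft : ∃[ N ] (∀ x → x ≤ N → c x ≡ 0ℤ)

-- The graph of the Fomin growth operator: IsGrowth κ μ lam ν says that
-- F̄(κ, μ, lam) = ν.  It is meant for κ ⪯ μ and κ ⪯ lam; ν is determined
-- because a signature is determined by its conjugate.
IsGrowth : ∀ {ℓ} (κ μ lam ν : Signature ℓ) → Set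
IsGrowth κ μ lam ν = Σ[ c ∈ (ℤ → ℤ) ] IsCarrier κ μ lam c ×
  (∀ x → conj ν x ≡ conj μ x + conj lam x - conj κ x + c (x - 1ℤ) - c x)

infixl 6 _⊕_

_⊕_ : ℤ × ℤ → ℤ × ℤ → ℤ × ℤ
(x , y) ⊕ (x′ , y′) = (x + x′ , y + y′)

e₁ e₂ : ℤ × ℤ
e₁ = (1ℤ , 0ℤ)
e₂ = (0ℤ , 1ℤ)

-- The quotient ℤ² / ∼ as a setoid: functions out of it are functions on ℤ²
-- that respect ∼.
Cylinder : ℕ → Setoid 0ℓ 0ℓ
Cylinder n = record
  { Carrier       = ℤ × ℤ
  ; _≈_           = λ (x , y) (x′ , y′) →
                      ∃[ k ] (x′ ≡ x + k * + n × y′ ≡ y - k * + n)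
  ; isEquivalence = record
    { refl  = λ {(x , y)} → 0ℤ , r₁ x (+ n) , r₂ y (+ n)
    ; sym   = λ { {x , y} (k , refl , refl) →
                  - k , s₁ x k (+ n) , s₂ y k (+ n) }
    ; trans = λ { {x , y} (k , refl , refl) (m , refl , refl) →
                  k + m , t₁ x k m (+ n) , t₂ y k m (+ n) }
    }
  }
  where
  r₁ : ∀ x n → x ≡ x + 0ℤ * n
  r₁ = solve-∀
  r₂ : ∀ y n → y ≡ y - 0ℤ * n
  r₂ = solve-∀
  s₁ : ∀ x k n → x ≡ x + k * n + (- k) * n
  s₁ = solve-∀
  s₂ : ∀ y k n → y ≡ y - k * n - (- k) * n
  s₂ = solve-∀
  t₁ : ∀ x k m n → x + k * n + m * n ≡ x + (k + m) * n
  t₁ = solve-∀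
  t₂ : ∀ y k m n → y - k * n - m * n ≡ y - (k + m) * n
  t₂ = solve-∀

record FominField (n ℓ : ℕ) : Set where
  field
    field-map : Func (Cylinder n) (Signatures ℓ)

  at : ℤ × ℤ → Signature ℓ
  at = Func.to field-map

  field
    interlacing₁ : ∀ p → at p ⪯ at (p ⊕ e₁)
    interlacing₂ : ∀ p → at p ⪯ at (p ⊕ e₂)
    growth       : ∀ p → IsGrowth (at p) (at (p ⊕ e₁)) (at (p ⊕ e₂))
                                  (at (p ⊕ e₁ ⊕ e₂))

record Partition (ℓ′ : ℕ) : Set where
  field
    parts      : Vec ℕ ℓ′
    decreasing : Linked ℕ._≥_ parts
    positive   : All (0 ℕ.<_) parts

-- (μ₁, …, μ_ℓ′, 0, …, 0)
padded : ∀ {ℓ′ ℓ} → ℓ′ ℕ.≤ ℓ → Partition ℓ′ → Vec ℤ ℓ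
padded ℓ′≤ℓ μ = padRight ℓ′≤ℓ 0ℤ (map +_ (Partition.parts μ))

-- (0, …, 0, μ_ℓ′, …, μ₁)
paddedReversed : ∀ {ℓ′ ℓ} → ℓ′ ℕ.≤ ℓ → Partition ℓ′ → Vec ℤ ℓ
paddedReversed ℓ′≤ℓ μ = reverse (padded ℓ′≤ℓ μ)

infixl 6 _+ᵛ_ _-ᵛ_

_+ᵛ_ _-ᵛ_ : ∀ {ℓ} → Vec ℤ ℓ → Vec ℤ ℓ → Vec ℤ ℓ
_+ᵛ_ = zipWith _+_
_-ᵛ_ = zipWith _-_

{-# OPTIONS --safe #-}
module Submission where

-- Row j of the signatures, seen on the cylinder, obeys the discrete wave equation except for
-- boxes that a blocked row hands over to the row above it.  The number of boxes handed over
-- is controlled by a quantity that is monotone and bounded, so after waiting long enough one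
-- finds a window without any; by then all rows move at constant speeds, and if the window is
-- long compared to the gaps between the rows, the speeds are sorted and nothing is ever handed
-- over again.  The same holds in the past, since the system is reversible.
--
-- That the two lists of speeds agree is a conservation law.  As for the discrete Toda lattice,
-- the k-th conserved quantity is the least cost of k disjoint particles running once around the
-- cylinder and hopping between rows.  A configuration of particles can be pushed through one
-- growth square at no extra cost; in the past the k slowest rows are such a configuration, and
-- in the future none costs less than the k smallest speeds.  This compares the k smallest
-- speeds in one direction, and reversing time gives the other.

open import Defs
open import Data.Bool.Base using (if_then_else_)
open import Data.Empty using (⊥-elim)
open import Data.Fin.Base using (fromℕ<)
open import Data.Integer.Base using (ℤ; +_; -[1+_]; 0ℤ; 1ℤ; _+_; _-_; -_; _*_; _≤_; _<_; _⊔_; ∣_∣)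
import Data.Integer.Base as ℤ
import Data.Integer.DivMod as ℤ
import Data.Integer.Properties as ℤ
open import Data.Integer.Tactic.RingSolver using (solve-∀)
open import Data.List.Base using (List; []; _∷_; length)
open import Data.Nat.Base as ℕ using (ℕ; zero; suc; z≤n; s≤s)
import Data.Nat.Properties as ℕ
open import Data.Product.Base using (_×_; _,_; Σ-syntax; ∃-syntax; proj₁; proj₂)
open import Data.Sum.Base using (_⊎_; inj₁; inj₂)
open import Data.Vec.Base as Vec using (Vec; []; _∷_; lookup; count)
import Data.Vec.Properties as Vec
open import Data.Vec.Relation.Unary.All using ([]; _∷_)
open import Data.Vec.Relation.Unary.Linked using (Linked; []; [-]; _∷_)
open import Function.Bundles using (Func)
open import Relation.Binary.PropositionalEquality
  using (_≡_; _≢_; refl; sym; trans; cong; cong₂; subst; subst₂)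
open import Relation.Nullary using (Dec; yes; no; does)

-- Integer inequalities, reduced to ring identities between differences.

by-difference : ∀ {a b e} → 0ℤ ≤ e → b - a ≡ e → a ≤ b
by-difference 0≤e eq = ℤ.0≤i-j⇒j≤i (subst (0ℤ ≤_) (sym eq) 0≤e)

infixl 6 _⊞_
_⊞_ : ∀ {a b} → 0ℤ ≤ a → 0ℤ ≤ b → 0ℤ ≤ a + b
_⊞_ = ℤ.+-mono-≤

diff : ∀ {a b} → a ≤ b → 0ℤ ≤ b - a
diff = ℤ.i≤j⇒0≤j-i

≡⇒0≤ : ∀ {a b} → a ≡ b → 0ℤ ≤ b - a
≡⇒0≤ eq = diff (ℤ.≤-reflexive eq)

drop-zero : ∀ {w c} → c ≡ 0ℤ → w + c ≤ w
drop-zero {w} refl = ℤ.≤-reflexive (ℤ.+-identityʳ w)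

i≤+∣i∣ : ∀ i → i ≤ + ∣ i ∣
i≤+∣i∣ (+ _)    = ℤ.≤-refl
i≤+∣i∣ -[1+ _ ] = ℤ.-≤+

-- Finite sums

∑ : ℕ → (ℕ → ℤ) → ℤ
∑ zero    f = 0ℤ
∑ (suc m) f = ∑ m f + f m

∑-cong : ∀ m {f g} → (∀ {i} → i ℕ.< m → f i ≡ g i) → ∑ m f ≡ ∑ m g
∑-cong zero    f≡g = refl
∑-cong (suc m) f≡g = cong₂ _+_ (∑-cong m λ i<m → f≡g (ℕ.m<n⇒m<1+n i<m)) (f≡g ℕ.≤-refl)

∑-mono : ∀ m {f g} → (∀ {i} → i ℕ.< m → f i ≤ g i) → ∑ m f ≤ ∑ m g
∑-mono zero    f≤g = ℤ.≤-refl
∑-mono (suc m) f≤g = ℤ.+-mono-≤ (∑-mono m λ i<m → f≤g (ℕ.m<n⇒m<1+n i<m)) (f≤g ℕ.≤-refl)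

∑-nonNeg : ∀ m {f} → (∀ {i} → i ℕ.< m → 0ℤ ≤ f i) → 0ℤ ≤ ∑ m f
∑-nonNeg zero    0≤f = ℤ.≤-refl
∑-nonNeg (suc m) 0≤f = ∑-nonNeg m (λ i<m → 0≤f (ℕ.m<n⇒m<1+n i<m)) ⊞ 0≤f ℕ.≤-refl

nonNeg-sum-zero : ∀ {a b} → 0ℤ ≤ a → 0ℤ ≤ b → a + b ≡ 0ℤ → a ≡ 0ℤ × b ≡ 0ℤ
nonNeg-sum-zero {a} {b} 0≤a 0≤b eq =
    ℤ.≤-antisym (by-difference (0≤b ⊞ ≡⇒0≤ eq) (eqᵃ a b)) 0≤a
  , ℤ.≤-antisym (by-difference (0≤a ⊞ ≡⇒0≤ eq) (eqᵇ a b)) 0≤b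
  where
  eqᵃ : ∀ a b → 0ℤ - a ≡ b + (0ℤ - (a + b))
  eqᵃ = solve-∀
  eqᵇ : ∀ a b → 0ℤ - b ≡ a + (0ℤ - (a + b))
  eqᵇ = solve-∀

∑≡0⇒≡0 : ∀ m {f} → (∀ {i} → i ℕ.< m → 0ℤ ≤ f i) → ∑ m f ≡ 0ℤ →
         ∀ {i} → i ℕ.< m → f i ≡ 0ℤ
∑≡0⇒≡0 (suc m) {f} 0≤f eq {i} i<1+m
  with nonNeg-sum-zero (∑-nonNeg m λ i<m → 0≤f (ℕ.m<n⇒m<1+n i<m)) (0≤f ℕ.≤-refl) eq | i ℕ.≟ m
... | _ , fm≡0 | yes refl = fm≡0
... | ∑≡0 , _  | no i≢m   =
  ∑≡0⇒≡0 m (λ i<m → 0≤f (ℕ.m<n⇒m<1+n i<m)) ∑≡0 (ℕ.≤∧≢⇒< (ℕ.≤-pred i<1+m) i≢m)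

∑-zero : ∀ m {f} → (∀ {i} → i ℕ.< m → f i ≡ 0ℤ) → ∑ m f ≡ 0ℤ
∑-zero zero    f≡0 = refl
∑-zero (suc m) f≡0 = cong₂ _+_ (∑-zero m λ i<m → f≡0 (ℕ.m<n⇒m<1+n i<m)) (f≡0 ℕ.≤-refl)

∑-+ : ∀ m (f g : ℕ → ℤ) → ∑ m (λ i → f i + g i) ≡ ∑ m f + ∑ m g
∑-+ zero    f g = refl
∑-+ (suc m) f g = trans (cong (λ s → s + (f m + g m)) (∑-+ m f g)) (eq (∑ m f) (∑ m g) (f m) (g m))
  where
  eq : ∀ a b c d → a + b + (c + d) ≡ a + c + (b + d)
  eq = solve-∀

∑-- : ∀ m (f g : ℕ → ℤ) → ∑ m (λ i → f i - g i) ≡ ∑ m f - ∑ m g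
∑-- zero    f g = refl
∑-- (suc m) f g = trans (cong (λ s → s + (f m - g m)) (∑-- m f g)) (eq (∑ m f) (∑ m g) (f m) (g m))
  where
  eq : ∀ a b c d → a - b + (c - d) ≡ a + c - (b + d)
  eq = solve-∀

∑-telescope : ∀ m (f : ℕ → ℤ) → ∑ m (λ i → f (suc i) - f i) ≡ f m - f 0
∑-telescope zero    f = sym (ℤ.+-inverseʳ (f 0))
∑-telescope (suc m) f = trans (cong (λ s → s + (f (suc m) - f m)) (∑-telescope m f)) (eq (f m) (f 0) (f (suc m)))
  where
  eq : ∀ a b c → a - b + (c - a) ≡ c - b
  eq = solve-∀

∑-suc : ∀ m (f : ℕ → ℤ) → ∑ (suc m) f ≡ f 0 + ∑ m (λ i → f (suc i))
∑-suc zero    f = ℤ.+-comm 0ℤ (f 0)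
∑-suc (suc m) f = trans (cong (λ s → s + f (suc m)) (∑-suc m f)) (ℤ.+-assoc (f 0) _ _)

∑-swap : ∀ m k (f : ℕ → ℕ → ℤ) → ∑ m (λ i → ∑ k (f i)) ≡ ∑ k (λ j → ∑ m (λ i → f i j))
∑-swap zero    k f = sym (∑-zero k λ _ → refl)
∑-swap (suc m) k f = trans (cong (λ s → s + ∑ k (f m)) (∑-swap m k f)) (sym (∑-+ k _ _))

-- The move of particles through a growth square

data Descending : ℕ → List ℕ → Set where
  []  : ∀ {b} → Descending b []
  _∷_ : ∀ {b i I} → i ℕ.< b → Descending i I → Descending b (i ∷ I)

weaken : ∀ {a b I} → a ℕ.≤ b → Descending a I → Descending b I
weaken a≤b []        = []
weaken a≤b (i<a ∷ d) = ℕ.≤-trans i<a a≤b ∷ d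

-- Particles sit on rows, listed from the lowest one up.  On the way around the cylinder they
-- retreat from ρ to κ and then advance from κ to μ; the last index is the cost.  The costs are
-- the exponents of the bidiagonal Lax matrices of the discrete Toda lattice.
data Retreat (κ ρ : ℕ → ℤ) : List ℕ → List ℕ → ℤ → Set where
  []   : Retreat κ ρ [] [] 0ℤ
  stay : ∀ {i I J w} → Retreat κ ρ I J w → Retreat κ ρ (i ∷ I) (i ∷ J) w
  up   : ∀ {j I J w} → Retreat κ ρ I J w →
         Retreat κ ρ (suc j ∷ I) (j ∷ J) (w + (κ j - ρ (suc j)))

data Advance (κ μ : ℕ → ℤ) : List ℕ → List ℕ → ℤ → Set where
  []   : Advance κ μ [] [] 0ℤ
  stay : ∀ {j J K w} → Advance κ μ J K w →
         Advance κ μ (j ∷ J) (j ∷ K) (w + (μ j - κ j))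
  down : ∀ {j J K w} → Advance κ μ J K w → Advance κ μ (j ∷ J) (suc j ∷ K) w

-- C k is the number of boxes handed over from row k to row k - 1.
record GrowthLaw (ℓ : ℕ) (κ μ ρ ν C : ℕ → ℤ) : Set where
  field
    C-nonNeg : ∀ k → 0ℤ ≤ C k
    C-first  : C 0 ≡ 0ℤ
    C-last   : C ℓ ≡ 0ℤ
    law      : ∀ {j} → j ℕ.< ℓ → ν j ≡ μ j + ρ j - κ j + C (suc j) - C j
    capped   : ∀ {j} → suc j ℕ.< ℓ → ν (suc j) ≤ κ j
    full     : ∀ {j} → suc j ℕ.< ℓ → C (suc j) ≢ 0ℤ → ν (suc j) ≡ κ j

module LocalMove {ℓ κ μ ρ ν C} (face : GrowthLaw ℓ κ μ ρ ν C) where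
  open GrowthLaw face

  -- The same passage from ρ to μ, but over the corner ν instead of κ. The bound `b` on the rows
  -- used at ν tells the next particle, which sits lower down, which rows are still vacant.
  record Rerouted (I K : List ℕ) (b : ℕ) (w : ℤ) : Set where
    constructor rerouted
    field
      {middle}  : List ℕ
      {w₁ w₂}   : ℤ
      advance   : Advance ρ ν I middle w₁
      retreat   : Retreat μ ν middle K w₂
      below     : Descending b middle
      cost      : w₁ + w₂ ≤ w

  relax : ∀ {I K b b′ w w′} → b ℕ.≤ b′ → w ≤ w′ →
          Rerouted I K b w → Rerouted I K b′ w′
  relax b≤b′ w≤w′ (rerouted a r d c) =
    rerouted a r (weaken b≤b′ d) (ℤ.≤-trans c w≤w′)

  -- A particle that returns to its row may now stay or go by way of the next row down, which
  -- costs nothing extra if that row is blocked (C (suc t) ≢ 0).  In the second case a particle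
  -- directly below cannot stay; preventing it costs at most C b, and nothing if the particle
  -- formerly went by way of the row above.
  record Bounds (I J K : List ℕ) (w : ℤ) : Set where
    field
      best   : ∀ {b} → Descending b I ⊎ Descending b K →
               Rerouted I K (suc b) w
      snug   : ∀ {b} → Descending b I → Descending b K →
               Rerouted I K b (w + C b)
      snugUp : ∀ {j} → Descending (suc j) I → Descending j J →
               Descending (suc j) K → Rerouted I K (suc j) w

  open Bounds

  private
    +C : ∀ {w} k → w ≤ w + C k
    +C {w} k = by-difference (C-nonNeg k) (eq w (C k))
      where eq : ∀ w c → w + c - w ≡ c
            eq = solve-∀

    top : ∀ {b i I} → Descending b (i ∷ I) → i ℕ.< b
    top (i<b ∷ _) = i<b

    fromSnug : ∀ {I J K t w} → Rerouted (t ∷ I) (t ∷ K) (suc t) w →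
               Bounds (t ∷ I) (J) (t ∷ K) w
    fromSnug s .best (inj₁ d) = relax (ℕ.m≤n⇒m≤1+n (top d)) ℤ.≤-refl s
    fromSnug s .best (inj₂ d) = relax (ℕ.m≤n⇒m≤1+n (top d)) ℤ.≤-refl s
    fromSnug s .snug {b} d _  = relax (top d) (+C b) s
    fromSnug s .snugUp d _ _  = relax (top d) ℤ.≤-refl s

  bounds : ∀ {I J K w₁ w₂} → Retreat κ ρ I J w₁ → Advance κ μ J K w₂ →
           Descending ℓ I → Descending ℓ J → Descending ℓ K → Bounds I J K (w₁ + w₂)
  bounds [] [] _ _ _ = record
    { best   = λ _ → rerouted [] [] [] ℤ.≤-refl
    ; snug   = λ {b} _ _ → rerouted [] [] [] (+C b)
    ; snugUp = λ _ _ _ → rerouted [] [] [] ℤ.≤-refl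
    }
  bounds (stay {i = t} {w = w} r) (stay {w = w′} a) (i< ∷ dI) (j< ∷ dJ) (k< ∷ dK) = record
    { best   = λ { (inj₁ d) → relax (s≤s (top d)) ℤ.≤-refl bestHere
                 ; (inj₂ d) → relax (s≤s (top d)) ℤ.≤-refl bestHere }
    ; snug   = snugHere
    ; snugUp = λ _ dJ′ _ → relax (s≤s (top dJ′)) ℤ.≤-refl bestHere
    }
    where
    IH : Bounds _ _ _ (w + w′)
    IH = bounds r a (weaken (ℕ.<⇒≤ i<) dI) (weaken (ℕ.<⇒≤ i<) dJ) (weaken (ℕ.<⇒≤ i<) dK)

    -- By `law`, staying on the way to ν costs `μ t - κ t + C (suc t) - C t`. The last term pays the
    -- surcharge of `snug` on the particles above, and `C (suc t)` is passed on as the new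
    -- surcharge.
    staying : Rerouted _ _ (suc t) (w + (w′ + (μ t - κ t)) + C (suc t))
    staying with snug IH dI dK
    ... | rerouted {w₁ = x} {y} a′ r′ d c =
      rerouted (stay a′) (stay r′) (ℕ.≤-refl ∷ d)
        (by-difference (diff c ⊞ ≡⇒0≤ (law i<))
          (eq w w′ (μ t) (κ t) (C (suc t)) (C t) x y (ν t) (ρ t)))
      where
      eq : ∀ w w′ m k c₁ c₀ x y n p →
           w + (w′ + (m - k)) + c₁ - (x + (n - p) + y) ≡
           (w + w′ + c₀ - (x + y)) + (m + p - k + c₁ - c₀ - n)
      eq = solve-∀

    bestHere : Rerouted _ _ (suc (suc t)) (w + (w′ + (μ t - κ t)))
    bestHere with C (suc t) ℤ.≟ 0ℤ
    ... | yes C≡0 = relax (ℕ.n≤1+n _)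
      (drop-zero C≡0) staying
    -- Row `suc t` is blocked, so `ν (suc t) ≡ κ t` and the detour through it costs `μ t - κ t`,
    -- just as before. This row exists, since `C-last` excludes `suc t ≡ ℓ`.
    ... | no  C≢0 with best IH (inj₁ dI)
    ...   | rerouted {w₁ = x} {y} a′ r′ d c =
      rerouted (down a′) (up r′) (ℕ.≤-refl ∷ d)
        (by-difference (diff c ⊞ ≡⇒0≤ (sym (full (ℕ.≤∧≢⇒< i< λ { refl → C≢0 C-last }) C≢0)))
          (eq w w′ (μ t) (κ t) x y (ν (suc t))))
      where
      eq : ∀ w w′ m k x y n →
           w + (w′ + (m - k)) - (x + (y + (m - n))) ≡ (w + w′ - (x + y)) + (n - k)
      eq = solve-∀

    snugHere : ∀ {b} → Descending b (t ∷ _) → Descending b (t ∷ _) →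
               Rerouted _ _ b (w + (w′ + (μ t - κ t)) + C b)
    snugHere {b} (t<b ∷ _) _ with suc t ℕ.≟ b
    -- Only staying keeps row `suc t` vacant here, and its surcharge is exactly the allowed `C b`.
    ... | yes refl = staying
    ... | no  t≢b  = relax (ℕ.≤∧≢⇒< t<b t≢b) (+C b) bestHere
  bounds (stay {i = t} {w = w} r) (down {w = w′} a) (i< ∷ dI) (j< ∷ dJ) (k< ∷ dK) = record
    { best   = λ { (inj₁ d) → relax (s≤s (top d)) ℤ.≤-refl here
                 ; (inj₂ d) → relax (ℕ.m≤n⇒m≤1+n (top d)) ℤ.≤-refl here }
    ; snug   = λ {b} _ d → relax (top d) (+C b) here
    ; snugUp = λ _ _ d → relax (top d) ℤ.≤-refl here
    }
    where
    here : Rerouted _ _ (suc (suc t)) (w + w′)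
    here with best (bounds r a (weaken (ℕ.<⇒≤ i<) dI) (weaken (ℕ.<⇒≤ j<) dJ) (weaken (ℕ.<⇒≤ k<) dK)) (inj₁ dI)
    ... | rerouted a′ r′ d c = rerouted (down a′) (stay r′) (ℕ.≤-refl ∷ d) c
  bounds (up {j = t} {w = w} r) (stay {w = w′} a) (i< ∷ dI) (j< ∷ dJ) (k< ∷ dK) = record
    { best   = λ { (inj₁ d) → relax (ℕ.m≤n⇒m≤1+n (top d)) ℤ.≤-refl here
                 ; (inj₂ d) → relax (s≤s (top d)) ℤ.≤-refl here }
    ; snug   = λ {b} d _ → relax (top d) (+C b) here
    ; snugUp = λ d _ _ → relax (top d) ℤ.≤-refl here
    }
    where
    -- The particle changes rows on the second leg instead of the first. Both routes cost
    -- `μ t - ρ (suc t)`, since the corner value cancels.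
    here : Rerouted _ _ (suc (suc t)) (w + (κ t - ρ (suc t)) + (w′ + (μ t - κ t)))
    here with best (bounds r a (weaken (ℕ.<⇒≤ i<) dI) (weaken (ℕ.<⇒≤ j<) dJ) (weaken (ℕ.<⇒≤ k<) dK)) (inj₂ dK)
    ... | rerouted {w₁ = x} {y} a′ r′ d c =
      rerouted (stay a′) (up r′) (ℕ.≤-refl ∷ d)
        (by-difference (diff c) (eq w w′ (κ t) (ρ (suc t)) (μ t) x y (ν (suc t))))
      where
      eq : ∀ w w′ k p m x y n →
           w + (k - p) + (w′ + (m - k)) - (x + (n - p) + (y + (m - n))) ≡ w + w′ - (x + y)
      eq = solve-∀
  bounds (up {j = t} {w = w} r) (down {w = w′} a) (i< ∷ dI) (j< ∷ dJ) (k< ∷ dK) =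
    fromSnug here
    where
    -- The particle used to dodge through row `t`, so at κ the particles above it were confined to
    -- rows above `t`. Hence `snugUp` keeps them out of row `suc t` for free, and by `capped`
    -- staying there is no dearer than the dodge.
    here : Rerouted _ _ (suc (suc t)) (w + (κ t - ρ (suc t)) + w′)
    here with snugUp (bounds r a (weaken (ℕ.<⇒≤ i<) dI) (weaken (ℕ.<⇒≤ j<) dJ) (weaken (ℕ.<⇒≤ k<) dK)) dI dJ dK
    ... | rerouted {w₁ = x} {y} a′ r′ d c =
      rerouted (stay a′) (stay r′) (ℕ.≤-refl ∷ d)
        (by-difference (diff c ⊞ diff (capped i<))
          (eq w w′ (κ t) (ρ (suc t)) x y (ν (suc t))))
      where
      eq : ∀ w w′ k p x y n →
           w + (k - p) + w′ - (x + (n - p) + y) ≡ (w + w′ - (x + y)) + (k - n)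
      eq = solve-∀

  reroute : ∀ {I J K w₁ w₂} → Retreat κ ρ I J w₁ → Advance κ μ J K w₂ →
            Descending ℓ I → Descending ℓ J → Descending ℓ K → Rerouted I K ℓ (w₁ + w₂)
  reroute r a dI dJ dK =
    relax ℕ.≤-refl (drop-zero C-last)
      (snug (bounds r a dI dJ dK) dI dK)

-- Rows in the coordinates time and position

infixl 7 _▹_

-- Iterated successor rather than addition, so that `t ▹ suc i` computes to the next time.
_▹_ : ℤ → ℕ → ℤ
t ▹ zero  = t
t ▹ suc i = ℤ.suc (t ▹ i)

▹-suc : ∀ t i → ℤ.suc t ▹ i ≡ ℤ.suc (t ▹ i)
▹-suc t zero    = refl
▹-suc t (suc i) = cong ℤ.suc (▹-suc t i)

▹-+ : ∀ t i → t ▹ i ≡ t + + i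
▹-+ t zero    = sym (ℤ.+-identityʳ t)
▹-+ t (suc i) = trans (cong ℤ.suc (▹-+ t i)) (eq t (+ i))
  where
  eq : ∀ t i → 1ℤ + (t + i) ≡ t + (1ℤ + i)
  eq = solve-∀

▹-▹ : ∀ t i j → t ▹ i ▹ j ≡ t ▹ (j ℕ.+ i)
▹-▹ t i zero    = refl
▹-▹ t i (suc j) = cong ℤ.suc (▹-▹ t i j)

0▹ : ∀ i → 0ℤ ▹ i ≡ + i
0▹ i = trans (▹-+ 0ℤ i) (ℤ.+-identityˡ (+ i))

≤⇒▹ : ∀ {s t} → s ≤ t → ∃[ r ] t ≡ s ▹ r
≤⇒▹ {s} {t} s≤t = ∣ t - s ∣ ,
  sym (trans (▹-+ s _) (trans (cong (λ z → s + z) (ℤ.0≤i⇒+∣i∣≡i (diff s≤t))) (eq s t)))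
  where
  eq : ∀ s t → s + (t - s) ≡ t
  eq = solve-∀

record Rows (n ℓ : ℕ) : Set where
  field
    q : ℤ → ℤ → ℕ → ℤ
    C : ℤ → ℤ → ℕ → ℤ
    periodic : ∀ t x m j → q t (x + m * + n) j ≡ q t x j
    mono₁ : ∀ t x {j} → j ℕ.< ℓ → q t x j ≤ q (ℤ.suc t) (ℤ.suc x) j
    mono₂ : ∀ t x {j} → j ℕ.< ℓ → q t x j ≤ q (ℤ.suc t) x j
    face  : ∀ t x → GrowthLaw ℓ (q t x) (q (ℤ.suc t) (ℤ.suc x)) (q (ℤ.suc t) x)
                              (q (ℤ.suc (ℤ.suc t)) (ℤ.suc x)) (C t x)

∑-extend : ∀ {k m} (f : ℕ → ℤ) → k ℕ.≤ m → (∀ {i} → i ℕ.< m → 0ℤ ≤ f i) → ∑ k f ≤ ∑ m f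
∑-extend {k} {zero}  f z≤n 0≤f = ℤ.≤-refl
∑-extend {k} {suc m} f k≤1+m 0≤f with k ℕ.≟ suc m
... | yes refl = ℤ.≤-refl
... | no  k≢   = by-difference
  (diff (∑-extend f (ℕ.≤-pred (ℕ.≤∧≢⇒< k≤1+m k≢)) λ i<m → 0≤f (ℕ.m<n⇒m<1+n i<m)) ⊞ 0≤f ℕ.≤-refl)
  (eq (∑ m f) (f m) (∑ k f))
  where
  eq : ∀ a b c → a + b - c ≡ a - c + b
  eq = solve-∀

bounded : ∀ m (f : ℕ → ℕ) → ∃[ B ] (∀ {i} → i ℕ.< m → f i ℕ.≤ B)
bounded zero    f = 0 , λ ()
bounded (suc m) f with bounded m f
... | B , f≤B = B ℕ.⊔ f m , bound
  where
  bound : ∀ {i} → i ℕ.< suc m → f i ℕ.≤ B ℕ.⊔ f m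
  bound {i} i<1+m with i ℕ.≟ m
  ... | yes refl = ℕ.m≤n⊔m B (f m)
  ... | no  i≢m  = ℕ.≤-trans (f≤B (ℕ.≤∧≢⇒< (ℕ.≤-pred i<1+m) i≢m)) (ℕ.m≤m⊔n B (f m))

suc-invariant : ∀ (f : ℤ → ℤ) → (∀ x → f (ℤ.suc x) ≡ f x) → ∀ x → f x ≡ f 0ℤ
suc-invariant f step (+ zero)        = refl
suc-invariant f step (+ suc i)       = trans (step (+ i)) (suc-invariant f step (+ i))
suc-invariant f step -[1+ zero ]     = sym (step -[1+ 0 ])
suc-invariant f step -[1+ suc i ]    =
  trans (sym (step -[1+ suc i ])) (suc-invariant f step -[1+ i ])

-- The discrete wave equation with a source.

module Wave (u c : ℤ → ℤ → ℤ)
  (law : ∀ t x → u (ℤ.suc (ℤ.suc t)) (ℤ.suc x) ≡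
                 u (ℤ.suc t) (ℤ.suc x) + u (ℤ.suc t) x - u t x + c t x) where

  -- An increment in one light-cone direction is transported unchanged along the other one, apart
  -- from the sources met on the way; `along₂` exchanges the two directions.
  along₁ : ∀ t x m → u (ℤ.suc (t ▹ m)) (x ▹ m) - u (t ▹ m) (x ▹ m) ≡
                     u (ℤ.suc t) x - u t x + ∑ m (λ i → c (t ▹ i) (x ▹ i))
  along₁ t x zero    = sym (ℤ.+-identityʳ _)
  along₁ t x (suc m) =
    trans (cong (λ z → z - u (ℤ.suc (t ▹ m)) (ℤ.suc (x ▹ m))) (law (t ▹ m) (x ▹ m)))
      (trans (eq (u (ℤ.suc (t ▹ m)) (ℤ.suc (x ▹ m))) (u (ℤ.suc (t ▹ m)) (x ▹ m)) (u (t ▹ m) (x ▹ m)) _)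
      (trans (cong (λ z → z + c (t ▹ m) (x ▹ m)) (along₁ t x m)) (ℤ.+-assoc (u (ℤ.suc t) x - u t x) _ _)))
    where
    eq : ∀ a b d e → a + b - d + e - a ≡ b - d + e
    eq = solve-∀

  along₂ : ∀ t x m → u (ℤ.suc (t ▹ m)) (ℤ.suc x) - u (t ▹ m) x ≡
                     u (ℤ.suc t) (ℤ.suc x) - u t x + ∑ m (λ i → c (t ▹ i) x)
  along₂ t x zero    = sym (ℤ.+-identityʳ _)
  along₂ t x (suc m) =
    trans (cong (λ z → z - u (ℤ.suc (t ▹ m)) x) (law (t ▹ m) x))
      (trans (eq (u (ℤ.suc (t ▹ m)) (ℤ.suc x)) (u (ℤ.suc (t ▹ m)) x) (u (t ▹ m) x) _)
      (trans (cong (λ z → z + c (t ▹ m) x) (along₂ t x m))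
        (ℤ.+-assoc (u (ℤ.suc t) (ℤ.suc x) - u t x) _ _)))
    where
    eq : ∀ a b d e → a + b - d + e - b ≡ a - d + e
    eq = solve-∀

  module Periodic (n : ℕ) (periodic : ∀ t x → u t (x ▹ n) ≡ u t x) where

    -- After `n` steps along the diagonal the position has gone once around, so the increment
    -- transported by `along₁` is found at the same place one period later.
    growth-step₂ : ∀ t x → u (ℤ.suc t ▹ n) x - u (ℤ.suc t) x ≡
                           u (t ▹ n) x - u t x + ∑ n (λ i → c (t ▹ i) (x ▹ i))
    growth-step₂ t x rewrite ▹-suc t n =
      trans (eq (u (ℤ.suc (t ▹ n)) x) (u (ℤ.suc t) x) (u (t ▹ n) x))
        (trans (cong (λ z → z + (u (t ▹ n) x - u (ℤ.suc t) x))
          (trans (sym (cong₂ _-_ (periodic (ℤ.suc (t ▹ n)) x) (periodic (t ▹ n) x))) (along₁ t x n)))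
        (eq′ (u (ℤ.suc t) x) (u t x) _ (u (t ▹ n) x)))
      where
      eq : ∀ a b d → a - b ≡ a - d + (d - b)
      eq = solve-∀
      eq′ : ∀ b e s d → b - e + s + (d - b) ≡ d - e + s
      eq′ = solve-∀

    growth-step₁ : ∀ t x → u (ℤ.suc t ▹ n) (ℤ.suc x) - u (ℤ.suc t) (ℤ.suc x) ≡
                           u (t ▹ n) x - u t x + ∑ n (λ i → c (t ▹ i) x)
    growth-step₁ t x rewrite ▹-suc t n =
      trans (eq (u (ℤ.suc (t ▹ n)) (ℤ.suc x)) (u (ℤ.suc t) (ℤ.suc x)) (u (t ▹ n) x))
        (trans (cong (λ z → z + (u (t ▹ n) x - u (ℤ.suc t) (ℤ.suc x))) (along₂ t x n))
        (eq′ (u (ℤ.suc t) (ℤ.suc x)) (u t x) _ (u (t ▹ n) x)))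
      where
      eq : ∀ a b d → a - b ≡ a - d + (d - b)
      eq = solve-∀
      eq′ : ∀ b e s d → b - e + s + (d - b) ≡ d - e + s
      eq′ = solve-∀

module RowsProperties {n ℓ : ℕ} (F : Rows n ℓ) where
  open Rows F public
  module Face t x = GrowthLaw (face t x)

  periodic▹ : ∀ t x j → q t (x ▹ n) j ≡ q t x j
  periodic▹ t x j = trans (cong (λ z → q t z j)
    (trans (▹-+ x n) (cong (λ z → x + z) (sym (ℤ.*-identityˡ (+ n)))))) (periodic t x 1ℤ j)

  head : ℕ → ℤ → ℤ → ℤ
  head k t x = ∑ k (q t x)

  -- In the sum of the first `k` laws the exchanges between these rows telescope. What remains is a
  -- wave equation with the nonnegative source `C t x k`.
  head-law : ∀ {k} → k ℕ.≤ ℓ → ∀ t x →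
    head k (ℤ.suc (ℤ.suc t)) (ℤ.suc x) ≡
    head k (ℤ.suc t) (ℤ.suc x) + head k (ℤ.suc t) x - head k t x + C t x k
  head-law {zero}  _   t x = sym (trans (ℤ.+-identityˡ _) (Face.C-first t x))
  head-law {suc k} k<ℓ t x =
    trans (cong₂ _+_ (head-law (ℕ.<⇒≤ k<ℓ) t x) (Face.law t x k<ℓ))
      (eq (head k (ℤ.suc t) (ℤ.suc x)) (head k (ℤ.suc t) x) (head k t x) (C t x k)
          (q (ℤ.suc t) (ℤ.suc x) k) (q (ℤ.suc t) x k) (q t x k) (C t x (suc k)))
    where
    eq : ∀ a b d c a′ b′ d′ c′ → a + b - d + c + (a′ + b′ - d′ + c′ - c) ≡
                                 a + a′ + (b + b′) - (d + d′) + c′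
    eq = solve-∀

  head-periodic : ∀ k t x m → head k t (x + m * + n) ≡ head k t x
  head-periodic k t x m = ∑-cong k λ {j} _ → periodic t x m j

  head-periodic▹ : ∀ k t x → head k t (x ▹ n) ≡ head k t x
  head-periodic▹ k t x = ∑-cong k λ {j} _ → periodic▹ t x j

  C-head : ∀ {k} → k ℕ.≤ ℓ → ∀ t x → C t x k ≡
    head k (ℤ.suc (ℤ.suc t)) (ℤ.suc x) -
    (head k (ℤ.suc t) (ℤ.suc x) + head k (ℤ.suc t) x - head k t x)
  C-head {k} k≤ℓ t x = sym (trans (cong (λ z → z - e) (head-law k≤ℓ t x)) (eq e (C t x k)))
    where
    e = head k (ℤ.suc t) (ℤ.suc x) + head k (ℤ.suc t) x - head k t x
    eq : ∀ e c → e + c - e ≡ c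
    eq = solve-∀

  -- Periodicity is built into `q` alone; `C` inherits it because `C-head` recovers `C` from the
  -- corners of its square.
  C-periodic : ∀ {k} → k ℕ.≤ ℓ → ∀ t x m → C t (x + m * + n) k ≡ C t x k
  C-periodic {k} k≤ℓ t x m = trans (C-head k≤ℓ t (x + m * + n)) (trans
    (cong₂ _-_ (shifted _)
      (cong₂ _-_ (cong₂ _+_ (shifted _) (head-periodic k _ x m)) (head-periodic k t x m)))
    (sym (C-head k≤ℓ t x)))
    where
    shifted : ∀ s → head k s (ℤ.suc (x + m * + n)) ≡ head k s (ℤ.suc x)
    shifted s = trans (cong (head k s) (sym (ℤ.+-assoc 1ℤ x (m * + n))))
                      (head-periodic k s (ℤ.suc x) m)

  mono₂▹ : ∀ t x m {j} → j ℕ.< ℓ → q t x j ≤ q (t ▹ m) x j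
  mono₂▹ t x zero    j<ℓ = ℤ.≤-refl
  mono₂▹ t x (suc m) j<ℓ = ℤ.≤-trans (mono₂▹ t x m j<ℓ) (mono₂ (t ▹ m) x j<ℓ)

  antitone : ∀ t x {j} → suc j ℕ.< ℓ → q t x (suc j) ≤ q t x j
  antitone t x j< = ℤ.≤-trans (mono₂ t x j<)
    (ℤ.≤-trans (mono₁ (ℤ.suc t) x j<) (Face.capped t x j<))

  speed : ℤ → ℤ → ℕ → ℤ
  speed t x j = q (t ▹ n) x j - q t x j

  Free : ℤ → Set
  Free t = ∀ x {k} → k ℕ.≤ ℓ → C t x k ≡ 0ℤ

  module RowWave {j} (j<ℓ : j ℕ.< ℓ) where
    open Wave (λ t x → q t x j) (λ t x → C t x (suc j) - C t x j)
      (λ t x → trans (Face.law t x j<ℓ) (ℤ.+-assoc (q (ℤ.suc t) (ℤ.suc x) j + q (ℤ.suc t) x j - q t x j) _ _)) public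
    open Periodic n (λ t x → periodic▹ t x j) public

  module HeadWave {k} (k≤ℓ : k ℕ.≤ ℓ) where
    open Wave (head k) (λ t x → C t x k) (head-law k≤ℓ) public
    open Periodic n (head-periodic▹ k) public

  speed-step₁ : ∀ t → (∀ {i} → i ℕ.< n → Free (t ▹ i)) → ∀ x {j} → j ℕ.< ℓ →
                speed (ℤ.suc t) (ℤ.suc x) j ≡ speed t x j
  speed-step₁ t free x j<ℓ = trans (RowWave.growth-step₁ j<ℓ t x)
    (trans (cong (λ z → speed t x _ + z) z) (ℤ.+-identityʳ _))
    where z = ∑-zero n λ i<n → cong₂ _-_ (free i<n x j<ℓ) (free i<n x (ℕ.<⇒≤ j<ℓ))

  speed-step₂ : ∀ t → (∀ {i} → i ℕ.< n → Free (t ▹ i)) → ∀ x {j} → j ℕ.< ℓ →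
                speed (ℤ.suc t) x j ≡ speed t x j
  speed-step₂ t free x j<ℓ = trans (RowWave.growth-step₂ j<ℓ t x)
    (trans (cong (λ z → speed t x _ + z) (∑-zero n λ {i} i<n → cong₂ _-_ (free i<n (x ▹ i) j<ℓ) (free i<n (x ▹ i) (ℕ.<⇒≤ j<ℓ))))
      (ℤ.+-identityʳ _))

  -- The speed at time `t + 1` and position `x + 1` equals both the speed at `t`, `x` and the one at
  -- `t`, `x + 1`.
  speed-uniform : ∀ t → (∀ {i} → i ℕ.< n → Free (t ▹ i)) → ∀ x {j} → j ℕ.< ℓ →
                  speed t x j ≡ speed t 0ℤ j
  speed-uniform t free x {j} j<ℓ = suc-invariant (λ x → speed t x j)
    (λ x → trans (sym (speed-step₂ t free (ℤ.suc x) j<ℓ)) (speed-step₁ t free x j<ℓ)) x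

-- The settled regime

record Settled {n ℓ} (F : Rows n ℓ) (T : ℤ) (v : ℕ → ℤ) : Set where
  open RowsProperties F
  field
    free       : ∀ {t} → T ≤ t → Free t
    steady     : ∀ {t} → T ≤ t → ∀ x {j} → j ℕ.< ℓ → speed t x j ≡ v j
    v-antitone : ∀ {j} → suc j ℕ.< ℓ → v (suc j) ≤ v j

module Future {n′ ℓ : ℕ} (F : Rows (suc n′) ℓ) where
  open RowsProperties F

  private
    n = suc n′

    gain : ℕ → ℤ → ℤ
    gain k t = head k (t ▹ n) 0ℤ - head k t 0ℤ

    -- `slope` counts a row the more often the higher it is, so each box handed upwards raises it.
    -- In `cap` every partial gain is replaced by the gain of all rows, which is conserved because
    -- nothing crosses level `ℓ`.
    slope cap source : ℤ → ℤ
    slope t  = ∑ ℓ (λ k → gain k t)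
    cap t    = ∑ ℓ (λ _ → gain ℓ t)
    source t = ∑ ℓ (λ k → ∑ n (λ i → C (t ▹ i) (0ℤ ▹ i) k))

    slope-suc : ∀ t → slope (ℤ.suc t) ≡ slope t + source t
    slope-suc t = trans (∑-cong ℓ λ k<ℓ → HeadWave.growth-step₂ (ℕ.<⇒≤ k<ℓ) t 0ℤ) (∑-+ ℓ _ _)

    slope-▹ : ∀ t m → slope (t ▹ m) ≡ slope t + ∑ m (λ s → source (t ▹ s))
    slope-▹ t zero    = sym (ℤ.+-identityʳ _)
    slope-▹ t (suc m) = trans (slope-suc (t ▹ m))
      (trans (cong (λ z → z + source (t ▹ m)) (slope-▹ t m)) (ℤ.+-assoc (slope t) _ _))

    cap-▹ : ∀ t m → cap (t ▹ m) ≡ cap t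
    cap-▹ t zero    = refl
    cap-▹ t (suc m) = trans (∑-cong ℓ λ _ → trans
      (HeadWave.growth-step₂ ℕ.≤-refl (t ▹ m) 0ℤ)
      (trans (cong (λ z → gain ℓ (t ▹ m) + z) (∑-zero n λ _ → Face.C-last _ _)) (ℤ.+-identityʳ _)))
      (cap-▹ t m)

    slope≤cap : ∀ t → slope t ≤ cap t
    slope≤cap t = ∑-mono ℓ λ {k} k<ℓ → subst₂ _≤_ (∑-- k _ _) (∑-- ℓ _ _)
      (∑-extend (speed t 0ℤ) (ℕ.<⇒≤ k<ℓ) λ j<ℓ → diff (mono₂▹ t 0ℤ n j<ℓ))

    -- The slope is bounded by the conserved cap, so it stalls over some window.
    quiet : ∀ (W : ℤ → ℕ) m t → cap t - slope t ≤ + m → ∃[ s ] slope (s ▹ W s) ≡ slope s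
    quiet W m t room with slope (t ▹ W t) ℤ.≟ slope t
    ... | yes eq = t , eq
    ... | no  ne = go m room
      where
      t′ = t ▹ W t

      rise : slope t < slope t′
      rise = ℤ.≤∧≢⇒< (by-difference (∑-nonNeg (W t) λ _ → ∑-nonNeg ℓ λ _ → ∑-nonNeg n λ _ → Face.C-nonNeg _ _ _)
        (trans (cong (λ z → z - slope t) (slope-▹ t (W t))) (eq (slope t) _))) (λ eq → ne (sym eq))
        where
        eq : ∀ a b → a + b - a ≡ b
        eq = solve-∀

      shrink : cap t′ - slope t′ < cap t - slope t
      shrink = subst (λ z → z - slope t′ < cap t - slope t) (sym (cap-▹ t (W t)))
        (ℤ.+-monoʳ-< (cap t) (ℤ.neg-mono-< rise))

      go : ∀ m → cap t - slope t ≤ + m → ∃[ s ] slope (s ▹ W s) ≡ slope s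
      go zero    room = ⊥-elim (ℤ.<⇒≱ (ℤ.<-≤-trans shrink room) (diff (slope≤cap t′)))
      go (suc m) room = quiet W m t′ (ℤ.i<j⇒i≤pred[j] (ℤ.<-≤-trans shrink room))

    residue : ∀ x → ∃[ i ] i ℕ.< n × (∃[ m ] x ≡ 0ℤ ▹ i + m * + n)
    residue x = x ℤ.% + n , ℤ.n%d<d x (+ n) , x ℤ./ + n ,
      trans (ℤ.a≡a%n+[a/n]*n x (+ n)) (cong (λ z → z + x ℤ./ + n * + n) (sym (0▹ (x ℤ.% + n))))

    -- A constant `slope` kills all sources, and a source lives on a diagonal. Position `i` at time
    -- `t ▹ n ▹ r` lies on the diagonal that starts at time `t ▹ (r + n - i)`; waiting `n` steps
    -- first makes this start no earlier than `t` for every `i < n`.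
    stalled⇒free : ∀ t W → slope (t ▹ W) ≡ slope t → ∀ {r} → r ℕ.+ n ℕ.< W → Free (t ▹ n ▹ r)
    stalled⇒free t W eq {r} r+n<W x {k} k≤ℓ with residue x | k ℕ.≟ ℓ
    ... | _ | yes refl = Face.C-last _ _
    ... | i , i<n , m , refl | no k≢ℓ = trans (C-periodic k≤ℓ _ _ m)
      (subst (λ s → C s (0ℤ ▹ i) k ≡ 0ℤ) same-time
        (∑≡0⇒≡0 n (λ _ → Face.C-nonNeg _ _ _)
          (∑≡0⇒≡0 ℓ (λ _ → ∑-nonNeg n λ _ → Face.C-nonNeg _ _ _)
            (∑≡0⇒≡0 W (λ _ → ∑-nonNeg ℓ λ _ → ∑-nonNeg n λ _ → Face.C-nonNeg _ _ _)
              no-source (ℕ.≤-<-trans (ℕ.m∸n≤m (r ℕ.+ n) i) r+n<W))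
            (ℕ.≤∧≢⇒< k≤ℓ k≢ℓ))
          i<n))
      where
      no-source : ∑ W (λ s → source (t ▹ s)) ≡ 0ℤ
      no-source = trans (cancel (slope t) _)
        (trans (cong (λ z → z - slope t) (trans (sym (slope-▹ t W)) eq)) (ℤ.+-inverseʳ (slope t)))
        where
        cancel : ∀ a s → s ≡ a + s - a
        cancel = solve-∀

      same-time : t ▹ (r ℕ.+ n ℕ.∸ i) ▹ i ≡ t ▹ n ▹ r
      same-time = trans (▹-▹ t _ i) (trans
        (cong (t ▹_) (ℕ.m+[n∸m]≡n (ℕ.≤-trans (ℕ.<⇒≤ i<n) (ℕ.m≤n+m n r))))
        (sym (▹-▹ t n r)))

  module Continue (b : ℤ) where
    v = speed b 0ℤ

    steady-before : ∀ r → (∀ {r′} → r′ ℕ.< r ℕ.+ n → Free (b ▹ r′)) →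
                    ∀ x {j} → j ℕ.< ℓ → speed (b ▹ r) x j ≡ v j
    steady-before zero    free x j<ℓ = speed-uniform b free x j<ℓ
    steady-before (suc r) free x j<ℓ = trans
      (speed-step₂ (b ▹ r) (λ {i} i<n → subst Free (sym (▹-▹ b r i))
        (free (ℕ.m<n⇒m<1+n (subst (i ℕ.+ r ℕ.<_) (ℕ.+-comm n r) (ℕ.+-monoˡ-< r i<n))))) x j<ℓ)
      (steady-before r (λ r′< → free (ℕ.m<n⇒m<1+n r′<)) x j<ℓ)

    module _ (v-antitone : ∀ {j} → suc j ℕ.< ℓ → v (suc j) ≤ v j) where

      -- Everything has moved by v since one period ago, so a collision now would need
      -- the gap to have been overrun already then.
      free-step : ∀ r → (∀ {r′} → r′ ℕ.< r ℕ.+ n → Free (b ▹ r′)) → Free (b ▹ (r ℕ.+ n))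
      free-step r free x {k} k≤ℓ = subst (λ s → C s x k ≡ 0ℤ) (trans (▹-▹ b r n) (cong (b ▹_) (ℕ.+-comm n r)))
        (descend (ℓ ℕ.∸ k) k (ℕ.m+[n∸m]≡n k≤ℓ))
        where
        s = b ▹ r

        moved : ∀ x {j} → j ℕ.< ℓ → q (s ▹ n) x j ≡ q s x j + v j
        moved x {j} j<ℓ = trans (eq (q (s ▹ n) x j) (q s x j))
          (cong (λ z → q s x j + z) (steady-before r free x j<ℓ))
          where
          eq : ∀ a b → a ≡ b + (a - b)
          eq = solve-∀

        moved′ : ∀ x {j} → j ℕ.< ℓ → q (ℤ.suc (s ▹ n)) x j ≡ q (ℤ.suc s) x j + v j
        moved′ x {j} j<ℓ = trans (cong (λ t → q t x j) (sym (▹-suc s n)))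
          (trans (eq (q (ℤ.suc s ▹ n) x j) (q (ℤ.suc s) x j))
          (cong (λ z → q (ℤ.suc s) x j + z) (trans
            (speed-step₂ s (λ {i} i<n → subst Free (sym (▹-▹ b r i))
              (free (subst (i ℕ.+ r ℕ.<_) (ℕ.+-comm n r) (ℕ.+-monoˡ-< r i<n)))) x j<ℓ)
            (steady-before r free x j<ℓ))))
          where
          eq : ∀ a b → a ≡ b + (a - b)
          eq = solve-∀

        free-s : Free s
        free-s = free (ℕ.m<m+n r (s≤s z≤n))

        -- From the last row upwards: once `C (suc (suc j))` vanishes, the law of row `suc j` yields
        -- `C (suc j)`. Were it nonzero, `full` would make it equal to a quantity that `capped` one
        -- period earlier and the order of the speeds force to be at most zero.
        descend : ∀ d k → k ℕ.+ d ≡ ℓ → C (s ▹ n) x k ≡ 0ℤ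
        descend zero    k eq = trans (cong (C (s ▹ n) x) (trans (sym (ℕ.+-identityʳ k)) eq)) (Face.C-last _ _)
        descend (suc d) zero eq = Face.C-first _ _
        descend (suc d) (suc j) eq with C (s ▹ n) x (suc j) ℤ.≟ 0ℤ
        ... | yes C≡0 = C≡0
        ... | no  C≢0 = ℤ.≤-antisym
          (by-difference
            (diff (v-antitone j′<ℓ) ⊞ diff (Face.capped s x j′<ℓ)
             ⊞ ≡⇒0≤ (trans (sym (moved x (ℕ.<⇒≤ j′<ℓ))) (sym (Face.full (s ▹ n) x j′<ℓ C≢0))))
            (trans (cong (λ z → 0ℤ - z) C-here)
              (eq′ (q (ℤ.suc s) (ℤ.suc x) (suc j)) (q (ℤ.suc s) x (suc j)) (q s x (suc j))
                 (v (suc j)) (v j) (q (ℤ.suc (ℤ.suc (s ▹ n))) (ℤ.suc x) (suc j)) (q s x j)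
                 _ ν-before)))
          (Face.C-nonNeg _ _ _)
          where
          j′<ℓ : suc j ℕ.< ℓ
          j′<ℓ = subst (suc j ℕ.<_) eq (ℕ.m<m+n (suc j) (s≤s z≤n))

          ν-before : q (ℤ.suc (ℤ.suc s)) (ℤ.suc x) (suc j) ≡
                     q (ℤ.suc s) (ℤ.suc x) (suc j) + q (ℤ.suc s) x (suc j) - q s x (suc j)
          ν-before = trans (Face.law s x j′<ℓ) (trans
            (cong₂ (λ c c′ → q (ℤ.suc s) (ℤ.suc x) (suc j) + q (ℤ.suc s) x (suc j) - q s x (suc j) + c - c′)
              (free-s x j′<ℓ) (free-s x (ℕ.<⇒≤ j′<ℓ))) (eq₀ _))
            where
            eq₀ : ∀ a → a + 0ℤ - 0ℤ ≡ a
            eq₀ = solve-∀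

          C-here : C (s ▹ n) x (suc j) ≡
                   q (ℤ.suc s) (ℤ.suc x) (suc j) + v (suc j) + (q (ℤ.suc s) x (suc j) + v (suc j))
                   - (q s x (suc j) + v (suc j)) - q (ℤ.suc (ℤ.suc (s ▹ n))) (ℤ.suc x) (suc j)
          C-here = trans (solved (q (ℤ.suc (s ▹ n)) (ℤ.suc x) (suc j) + q (ℤ.suc (s ▹ n)) x (suc j) - q (s ▹ n) x (suc j)) _ _ (Face.law (s ▹ n) x j′<ℓ)
              (descend d (suc (suc j)) (trans (sym (ℕ.+-suc (suc j) d)) eq)))
            (cong (λ z → z - q (ℤ.suc (ℤ.suc (s ▹ n))) (ℤ.suc x) (suc j))
              (cong₂ _-_ (cong₂ _+_ (moved′ (ℤ.suc x) j′<ℓ) (moved′ x j′<ℓ)) (moved x j′<ℓ)))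
            where
            solved : ∀ e c c⁺ {ν} → ν ≡ e + c⁺ - c → c⁺ ≡ 0ℤ → c ≡ e - ν
            solved e c _ refl refl = eq₂ e c
              where
              eq₂ : ∀ e c → c ≡ e - (e + 0ℤ - c)
              eq₂ = solve-∀

          eq′ : ∀ m p k v′ v ν κ ν₀ → ν₀ ≡ m + p - k →
                0ℤ - (m + v′ + (p + v′) - (k + v′) - ν) ≡ v - v′ + (κ - ν₀) + (ν - (κ + v))
          eq′ m p k v′ v ν κ _ refl = eq₂ m p k v′ v ν κ
            where
            eq₂ : ∀ m p k v′ v ν κ →
                  0ℤ - (m + v′ + (p + v′) - (k + v′) - ν) ≡ v - v′ + (κ - (m + p - k)) + (ν - (κ + v))
            eq₂ = solve-∀

      free-forever : ∀ {M} → n ℕ.≤ M → (∀ {r} → r ℕ.< M → Free (b ▹ r)) → ∀ r → Free (b ▹ r)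
      free-forever {M} n≤M free r = upTo (suc r) ℕ.≤-refl
        where
        upTo : ∀ R {r} → r ℕ.< R → Free (b ▹ r)
        upTo (suc R) {r} r<1+R with r ℕ.≟ R | r ℕ.<? M
        ... | no r≢R   | _       = upTo R (ℕ.≤∧≢⇒< (ℕ.≤-pred r<1+R) r≢R)
        ... | yes refl | yes r<M = free r<M
        ... | yes refl | no r≮M  = subst (λ z → Free (b ▹ z)) (ℕ.m∸n+n≡m n≤r)
          (free-step (r ℕ.∸ n) λ {r′} r′< → upTo r (subst (r′ ℕ.<_) (ℕ.m∸n+n≡m n≤r) r′<))
          where n≤r = ℕ.≤-trans n≤M (ℕ.≮⇒≥ r≮M)

    jump : ∀ K → (∀ {r} → r ℕ.< K ℕ.* n → Free (b ▹ r)) → ∀ {j} → j ℕ.< ℓ →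
           q (b ▹ (K ℕ.* n)) 0ℤ j ≡ q b 0ℤ j + + K * v j
    jump zero    free {j} j<ℓ = sym (ℤ.+-identityʳ _)
    jump (suc K) free {j} j<ℓ = trans (cong (λ t → q t 0ℤ j) (sym (▹-▹ b (K ℕ.* n) n)))
      (trans (eq (q (b ▹ (K ℕ.* n) ▹ n) 0ℤ j) (q (b ▹ (K ℕ.* n)) 0ℤ j))
      (trans (cong₂ _+_
          (steady-before (K ℕ.* n) (λ {r′} r′< → free (subst (r′ ℕ.<_) (ℕ.+-comm (K ℕ.* n) n) r′<)) 0ℤ j<ℓ)
          (jump K (λ r< → free (ℕ.≤-trans r< (ℕ.m≤n+m _ n))) j<ℓ))
        (eq′ (v j) (q b 0ℤ j) (+ K))))
      where
      eq : ∀ a b → a ≡ a - b + b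
      eq = solve-∀
      eq′ : ∀ v q K → v + (q + K * v) ≡ q + (1ℤ + K) * v
      eq′ = solve-∀

    -- Speeds are integers, so a faster row gains at least one box per period on the row above and
    -- would overtake it within `suc G` periods, against `antitone`.
    gaps-bound-speeds : ∀ G → (∀ {r} → r ℕ.< suc G ℕ.* n → Free (b ▹ r)) → ∀ {j} → suc j ℕ.< ℓ →
                        q b 0ℤ j - q b 0ℤ (suc j) ≤ + G → v (suc j) ≤ v j
    gaps-bound-speeds G free {j} j<ℓ gap≤G with v (suc j) ℤ.≤? v j
    ... | yes v≤v = v≤v
    ... | no  v≰v = ⊥-elim (ℕ.1+n≰n (ℤ.drop‿+≤+ (ℤ.≤-trans overrun gap≤G)))
      where
      K = suc G

      faster : 0ℤ ≤ + K * (v (suc j) - (1ℤ + v j))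
      faster = subst (_≤ + K * (v (suc j) - (1ℤ + v j))) (ℤ.*-zeroʳ (+ K))
        (ℤ.*-monoˡ-≤-nonNeg (+ K) (diff (ℤ.i<j⇒suc[i]≤j (ℤ.≰⇒> v≰v))))

      overrun : + K ≤ q b 0ℤ j - q b 0ℤ (suc j)
      overrun = by-difference
        (diff (subst₂ _≤_ (jump K free j<ℓ) (jump K free (ℕ.<⇒≤ j<ℓ)) (antitone (b ▹ (K ℕ.* n)) 0ℤ j<ℓ)) ⊞ faster)
        (eq (+ K) (q b 0ℤ j) (q b 0ℤ (suc j)) (v j) (v (suc j)))
        where
        eq : ∀ K q q′ v v′ → q - q′ - K ≡ q + K * v - (q′ + K * v′) + K * (v′ - (1ℤ + v))
        eq = solve-∀

  settles : ∃[ T ] ∃[ v ] Settled F T v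
  settles with quiet W _ 0ℤ (ℤ.≤-reflexive (sym (ℤ.0≤i⇒+∣i∣≡i (diff (slope≤cap 0ℤ)))))
    where
    gap : ℤ → ℕ → ℕ
    gap t j = ∣ q (t ▹ n) 0ℤ j - q (t ▹ n) 0ℤ (suc j) ∣
    W : ℤ → ℕ
    -- `suc G` periods for the gaps at time `t ▹ n`, another `n` for the delay in `stalled⇒free`,
    -- and the outer `suc` for its strict bound. The length depends on the start of the window
    -- because the gaps do.
    W t = suc (suc (proj₁ (bounded ℓ (gap t))) ℕ.* n ℕ.+ n)
  ... | t , stalled = b , v , record
    { free       = free
    ; steady     = λ {t} b≤t → steady b≤t
    ; v-antitone = antitone-v
    }
    where
    b = t ▹ n
    open Continue b
    G = proj₁ (bounded ℓ λ j → ∣ q b 0ℤ j - q b 0ℤ (suc j) ∣)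

    window : ∀ {r} → r ℕ.< suc G ℕ.* n → Free (b ▹ r)
    window r< = stalled⇒free t _ stalled (s≤s (ℕ.+-monoˡ-≤ n (ℕ.<⇒≤ r<)))

    antitone-v : ∀ {j} → suc j ℕ.< ℓ → v (suc j) ≤ v j
    antitone-v {j} j<ℓ = gaps-bound-speeds G window j<ℓ (ℤ.≤-trans
      (ℤ.≤-reflexive (sym (ℤ.0≤i⇒+∣i∣≡i (diff (antitone b 0ℤ j<ℓ)))))
      (ℤ.+≤+ (proj₂ (bounded ℓ λ j → ∣ q b 0ℤ j - q b 0ℤ (suc j) ∣) (ℕ.<⇒≤ j<ℓ))))

    free : ∀ {t} → b ≤ t → Free t
    free b≤t with ≤⇒▹ b≤t
    ... | r , refl = free-forever antitone-v (ℕ.m≤m+n n (G ℕ.* n)) window r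

    steady : ∀ {t} → b ≤ t → ∀ x {j} → j ℕ.< ℓ → speed t x j ≡ v j
    steady b≤t with ≤⇒▹ b≤t
    ... | r , refl = steady-before r λ {r′} _ → free-forever antitone-v (ℕ.m≤m+n n (G ℕ.* n)) window r′

-- Loops of particles around the cylinder

supremum : ∀ m (f : ℕ → ℤ) →
  ∃[ s ] (∀ {i} → i ℕ.< suc m → f i ≤ s) × (∃[ i ] i ℕ.< suc m × s ≡ f i)
supremum zero    f = f 0 , (λ { (s≤s z≤n) → ℤ.≤-refl }) , 0 , s≤s z≤n , refl
supremum (suc m) f with supremum m f
... | s , f≤s , i , i< , s≡fi with ℤ.≤-total s (f (suc m))
...   | inj₁ s≤f = f (suc m) , bound , suc m , ℕ.≤-refl , refl
  where
  bound : ∀ {j} → j ℕ.< suc (suc m) → f j ≤ f (suc m)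
  bound {j} j< with j ℕ.≟ suc m
  ... | yes refl = ℤ.≤-refl
  ... | no  j≢   = ℤ.≤-trans (f≤s (ℕ.≤∧≢⇒< (ℕ.≤-pred j<) j≢)) s≤f
...   | inj₂ f≤ = s , bound , i , ℕ.m<n⇒m<1+n i< , s≡fi
  where
  bound : ∀ {j} → j ℕ.< suc (suc m) → f j ≤ s
  bound {j} j< with j ℕ.≟ suc m
  ... | yes refl = f≤
  ... | no  j≢   = f≤s (ℕ.≤∧≢⇒< (ℕ.≤-pred j<) j≢)

total : (ℕ → ℤ) → List ℕ → ℤ
total f []      = 0ℤ
total f (i ∷ I) = total f I + f i

initial : ℕ → List ℕ
initial zero    = []
initial (suc k) = k ∷ initial k

initial-descending : ∀ {b} k → k ℕ.≤ b → Descending b (initial k)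
initial-descending zero    _   = []
initial-descending (suc k) k<b = k<b ∷ initial-descending k ℕ.≤-refl

length-initial : ∀ k → length (initial k) ≡ k
length-initial zero    = refl
length-initial (suc k) = cong suc (length-initial k)

retreat-in-place : ∀ {κ ρ} k → Retreat κ ρ (initial k) (initial k) 0ℤ
retreat-in-place zero    = []
retreat-in-place (suc k) = stay (retreat-in-place k)

advance-in-place : ∀ {κ μ} k → Advance κ μ (initial k) (initial k) (∑ k (λ j → μ j - κ j))
advance-in-place zero    = []
advance-in-place (suc k) = stay (advance-in-place k)

-- Used where a loop closes: the rows at positions `n` and `0` agree only pointwise.
retreat-cong : ∀ {κ κ′ ρ ρ′ I J w} → (∀ j → κ j ≡ κ′ j) → (∀ j → ρ j ≡ ρ′ j) →
               Retreat κ ρ I J w → Retreat κ′ ρ′ I J w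
retreat-cong κ≡ ρ≡ []       = []
retreat-cong κ≡ ρ≡ (stay r) = stay (retreat-cong κ≡ ρ≡ r)
retreat-cong {κ′ = κ′} {ρ′ = ρ′} κ≡ ρ≡ (up {j} {w = w} r) =
  subst (λ z → Retreat κ′ ρ′ _ _ (w + z)) (sym (cong₂ _-_ (κ≡ j) (ρ≡ (suc j))))
    (up (retreat-cong κ≡ ρ≡ r))

total-retreat : ∀ {ℓ κ ρ} ψ → (∀ {j} → suc j ℕ.< ℓ → ψ j ≤ ψ (suc j) + (κ j - ρ (suc j))) →
                ∀ {I J w} → Retreat κ ρ I J w → Descending ℓ I → total ψ J ≤ total ψ I + w
total-retreat ψ ψ-up [] _ = ℤ.≤-refl
total-retreat ψ ψ-up (stay {i} {I} {J} {w} r) (i<ℓ ∷ d) =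
  by-difference (diff (total-retreat ψ ψ-up r (weaken (ℕ.<⇒≤ i<ℓ) d)))
    (eq (total ψ I) (ψ i) w (total ψ J))
  where
  eq : ∀ a b c d → a + b + c - (d + b) ≡ a + c - d
  eq = solve-∀
total-retreat {κ = κ} {ρ} ψ ψ-up (up {j} {I} {J} {w} r) (i<ℓ ∷ d) =
  by-difference (diff (total-retreat ψ ψ-up r (weaken (ℕ.<⇒≤ i<ℓ) d)) ⊞ diff (ψ-up i<ℓ))
    (eq (total ψ I) (ψ (suc j)) w (total ψ J) (κ j - ρ (suc j)) (ψ j))
  where
  eq : ∀ a b c d e f → a + b + (c + e) - (d + f) ≡ a + c - d + (b + e - f)
  eq = solve-∀

total-advance : ∀ {ℓ κ μ} ψ ψ′ → (∀ {j} → j ℕ.< ℓ → ψ′ j ≤ ψ j + (μ j - κ j)) →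
                (∀ {j} → suc j ℕ.< ℓ → ψ′ (suc j) ≤ ψ j) →
                ∀ {J K w} → Advance κ μ J K w → Descending ℓ K → total ψ′ K ≤ total ψ J + w
total-advance ψ ψ′ ψ-stay ψ-down [] _ = ℤ.≤-refl
total-advance {κ = κ} {μ} ψ ψ′ ψ-stay ψ-down (stay {j} {J} {K} {w} a) (k<ℓ ∷ d) =
  by-difference (diff (total-advance ψ ψ′ ψ-stay ψ-down a (weaken (ℕ.<⇒≤ k<ℓ) d)) ⊞ diff (ψ-stay k<ℓ))
    (eq (total ψ J) (ψ j) w (total ψ′ K) (μ j - κ j) (ψ′ j))
  where
  eq : ∀ a b c d e f → a + b + (c + e) - (d + f) ≡ a + c - d + (b + e - f)
  eq = solve-∀
total-advance ψ ψ′ ψ-stay ψ-down (down {j} {J} {K} {w} a) (k<ℓ ∷ d) =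
  by-difference (diff (total-advance ψ ψ′ ψ-stay ψ-down a (weaken (ℕ.<⇒≤ k<ℓ) d)) ⊞ diff (ψ-down k<ℓ))
    (eq (total ψ J) (ψ j) w (total ψ′ K) (ψ′ (suc j)))
  where
  eq : ∀ a b c d f → a + b + c - (d + f) ≡ a + c - d + (b - f)
  eq = solve-∀

total-cong : ∀ {f g h : ℕ → ℤ} {b I} → (∀ {j} → j ℕ.< b → f j ≡ g j + h j) → Descending b I →
             total f I ≡ total g I + total h I
total-cong f≡ [] = refl
total-cong {f} {g} {h} f≡ (_∷_ {i = i} {I} i<b d) = trans
  (cong₂ _+_ (total-cong {f} {g} {h} (λ j<i → f≡ (ℕ.<-trans j<i i<b)) d) (f≡ i<b))
  (eq (total g I) (total h I) (g i) (h i))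
  where
  eq : ∀ a b c d → a + b + (c + d) ≡ a + c + (b + d)
  eq = solve-∀

antitone-≤ : ∀ {ℓ} {v : ℕ → ℤ} → (∀ {j} → suc j ℕ.< ℓ → v (suc j) ≤ v j) →
             ∀ {i j} → i ℕ.≤ j → j ℕ.< ℓ → v j ≤ v i
antitone-≤ v↓ {i} {zero}  z≤n _ = ℤ.≤-refl
antitone-≤ v↓ {i} {suc j} i≤j j<ℓ with i ℕ.≟ suc j
... | yes refl = ℤ.≤-refl
... | no  i≢   = ℤ.≤-trans (v↓ j<ℓ) (antitone-≤ v↓ (ℕ.≤-pred (ℕ.≤∧≢⇒< i≤j i≢)) (ℕ.<⇒≤ j<ℓ))

-- Counting from zero, the `m`-th member of a descending list below `b` is at most `b ∸ suc m`, and
-- `v` is antitone.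
smallest-total : ∀ {ℓ} {v : ℕ → ℤ} → (∀ {j} → suc j ℕ.< ℓ → v (suc j) ≤ v j) →
                 ∀ {b I} → b ℕ.≤ ℓ → Descending b I →
                 ∑ (length I) (λ m → v (b ℕ.∸ suc m)) ≤ total v I
smallest-total v↓ b≤ℓ [] = ℤ.≤-refl
smallest-total {v = v} v↓ {suc b} {i ∷ I} b<ℓ (s≤s i≤b ∷ d) = ℤ.≤-trans
  (ℤ.≤-reflexive (trans (∑-suc (length I) (λ m → v (b ℕ.∸ m))) (ℤ.+-comm (v b) _)))
  (ℤ.+-mono-≤ (smallest-total v↓ (ℕ.<⇒≤ b<ℓ) (weaken i≤b d)) (antitone-≤ v↓ i≤b b<ℓ))

module Loops {n′ ℓ : ℕ} (F : Rows (suc n′) ℓ) where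
  open RowsProperties F

  private
    n = suc n′

  -- J x and P x are the particles at the vertices (t , x) and (t + 1 , x) of a zigzag.
  record Loop (t : ℤ) (k : ℕ) (w : ℤ) : Set where
    field
      P J        : ℕ → List ℕ
      r a        : ℕ → ℤ
      closed     : P n ≡ P 0
      retreats   : ∀ x → Retreat (q t (+ x)) (q (ℤ.suc t) (+ x)) (P x) (J x) (r x)
      advances   : ∀ x → Advance (q t (+ x)) (q (ℤ.suc t) (+ suc x)) (J x) (P (suc x)) (a x)
      P-descends : ∀ x → Descending ℓ (P x)
      J-descends : ∀ x → Descending ℓ (J x)
      size       : length (P 0) ≡ k
      cost       : ∑ n (λ x → r x + a x) ≤ w

  standing : ∀ t k → k ℕ.≤ ℓ →
    Loop t k (∑ n (λ x → ∑ k (λ j → q (ℤ.suc t) (+ suc x) j - q t (+ x) j)))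
  standing t k k≤ℓ = record
    { P          = λ _ → initial k
    ; J          = λ _ → initial k
    ; r          = λ _ → 0ℤ
    ; a          = λ x → ∑ k (λ j → q (ℤ.suc t) (+ suc x) j - q t (+ x) j)
    ; closed     = refl
    ; retreats   = λ _ → retreat-in-place k
    ; advances   = λ _ → advance-in-place k
    ; P-descends = λ _ → initial-descending k k≤ℓ
    ; J-descends = λ _ → initial-descending k k≤ℓ
    ; size       = length-initial k
    ; cost       = ℤ.≤-reflexive (∑-cong n λ _ → ℤ.+-identityˡ _)
    }

  -- Every square flips one lower corner of the zigzag to the opposite upper corner. The former
  -- upper vertices become the lower ones, so `P` turns into the new `J`.
  push : ∀ {t k w} → Loop t k w → Loop (ℤ.suc t) k w
  push {t} {k} {w} L = record
    { P          = P′
    ; J          = P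
    ; r          = r′
    ; a          = λ x → Rerouted.w₁ (turn x)
    ; closed     = refl
    ; retreats   = retreats′
    ; advances   = λ x → Rerouted.advance (turn x)
    ; P-descends = P′-descends
    ; J-descends = P-descends
    ; size       = trans (same-length (Rerouted.retreat (turn n′))) (trans (cong length closed) size)
    ; cost       = ℤ.≤-trans (ℤ.≤-reflexive rotate)
                     (ℤ.≤-trans (∑-mono n λ {x} _ → Rerouted.cost (turn x)) cost)
    }
    where
    open Loop L

    turn : ∀ x → LocalMove.Rerouted (face t (+ x)) (P x) (P (suc x)) ℓ (r x + a x)
    turn x = LocalMove.reroute (face t (+ x)) (retreats x) (advances x)
      (P-descends x) (J-descends x) (P-descends (suc x))

    module Rerouted = LocalMove.Rerouted

    -- The last square produces the vertex at position `n`, which is also the one at position `0`.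
    P′ : ℕ → List ℕ
    P′ zero    = Rerouted.middle (turn n′)
    P′ (suc x) = Rerouted.middle (turn x)

    r′ : ℕ → ℤ
    r′ zero    = Rerouted.w₂ (turn n′)
    r′ (suc x) = Rerouted.w₂ (turn x)

    P′-descends : ∀ x → Descending ℓ (P′ x)
    P′-descends zero    = Rerouted.below (turn n′)
    P′-descends (suc x) = Rerouted.below (turn x)

    wrap : ∀ t j → q t (+ n) j ≡ q t 0ℤ j
    wrap t j = trans (cong (λ x → q t x j) (sym (0▹ n))) (periodic▹ t 0ℤ j)

    retreats′ : ∀ x → Retreat (q (ℤ.suc t) (+ x)) (q (ℤ.suc (ℤ.suc t)) (+ x)) (P′ x) (P x) (r′ x)
    retreats′ zero    = subst (λ I → Retreat _ _ (P′ 0) I (r′ 0)) closed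
      (retreat-cong (wrap _) (wrap _) (Rerouted.retreat (turn n′)))
    retreats′ (suc x) = Rerouted.retreat (turn x)

    same-length : ∀ {κ ρ I J w} → Retreat κ ρ I J w → length I ≡ length J
    same-length []       = refl
    same-length (stay r) = cong suc (same-length r)
    same-length (up r)   = cong suc (same-length r)

    -- The loop now opens with the retreat made in the last square; the costs are only permuted
    -- cyclically.
    rotate : ∑ n (λ x → r′ x + Rerouted.w₁ (turn x)) ≡ ∑ n (λ x → Rerouted.w₁ (turn x) + Rerouted.w₂ (turn x))
    rotate = trans (∑-+ n r′ _) (trans
      (cong (λ z → z + ∑ n (λ x → Rerouted.w₁ (turn x))) (trans (∑-suc n′ r′) (ℤ.+-comm (r′ 0) _)))
      (trans (ℤ.+-comm _ (∑ n (λ x → Rerouted.w₁ (turn x)))) (sym (∑-+ n _ _))))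

  push▹ : ∀ {t k w} m → Loop t k w → Loop (t ▹ m) k w
  push▹ zero    L = L
  push▹ (suc m) L = push (push▹ m L)

  module Settle {T v} (S : Settled F T v) {b} (T≤b : T ≤ b) where
    open Settled S

    private
      f g : ℕ → ℕ → ℤ
      f x j = q (b ▹ x) (+ x) j
      g m j = q (b ▹ m) 0ℤ j - q b 0ℤ j

      T≤ : ∀ m → T ≤ b ▹ m
      T≤ zero    = T≤b
      T≤ (suc m) = ℤ.≤-trans (T≤ m) (ℤ.i≤suc[i] (b ▹ m))

      commute : ∀ x m → b ▹ x ▹ m ≡ b ▹ m ▹ x
      commute x m = trans (▹-▹ b x m) (trans (cong (b ▹_) (ℕ.+-comm m x)) (sym (▹-▹ b m x)))

      -- The solution of d'Alembert: without exchanges a row is a function of one light-cone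
      -- coordinate plus a function of the other.
      grid : ∀ x m {j} → j ℕ.< ℓ → q (b ▹ x ▹ m) (+ x) j ≡ f x j + g m j
      grid x zero    {j} j<ℓ = eq (f x j) (q b 0ℤ j)
        where
        eq : ∀ a b → a ≡ a + (b - b)
        eq = solve-∀
      grid x (suc m) {j} j<ℓ = trans
        (eq (q (ℤ.suc (b ▹ x ▹ m)) (+ x) j) (q (b ▹ x ▹ m) (+ x) j))
        (trans (cong₂ _+_ (grid x m j<ℓ) same-rise)
        (eq′ (f x j) (q (b ▹ m) 0ℤ j) (q b 0ℤ j) (q (b ▹ suc m) 0ℤ j)))
        where
        eq : ∀ a b → a ≡ b + (a - b)
        eq = solve-∀
        eq′ : ∀ f c d e → f + (c - d) + (e - c) ≡ f + (e - d)
        eq′ = solve-∀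
        same-rise : q (ℤ.suc (b ▹ x ▹ m)) (+ x) j - q (b ▹ x ▹ m) (+ x) j ≡
                    q (b ▹ suc m) 0ℤ j - q (b ▹ m) 0ℤ j
        same-rise = trans
          (cong₂ (λ s y → q (ℤ.suc s) y j - q s y j) (commute x m) (sym (0▹ x)))
          (trans (RowWave.along₁ j<ℓ (b ▹ m) 0ℤ x)
          (trans (cong (λ z → q (b ▹ suc m) 0ℤ j - q (b ▹ m) 0ℤ j + z)
            (∑-zero x λ {i} _ → cong₂ _-_ (free′ i j<ℓ) (free′ i (ℕ.<⇒≤ j<ℓ)))) (ℤ.+-identityʳ _)))
          where
          free′ : ∀ i {k} → k ℕ.≤ ℓ → C (b ▹ m ▹ i) (0ℤ ▹ i) k ≡ 0ℤ
          free′ i = free (subst (T ≤_) (sym (▹-▹ b m i)) (T≤ (i ℕ.+ m))) (0ℤ ▹ i)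

      -- `capped` with the variables separated: the left side depends on `x` only, the right side on
      -- `m` only. The maximum `K j` of the left side over one period is attained, so it lies below
      -- every right side as well; `ψ-down` uses the first bound and `ψ-up` the second.
      order : ∀ x m {j} → suc j ℕ.< ℓ → f (suc x) (suc j) - f x j ≤ g m j - g (suc m) (suc j)
      order x m {j} j<ℓ = by-difference
        (diff (subst₂ _≤_
          (trans (cong (λ s → q (ℤ.suc s) (+ suc x) (suc j)) (sym (▹-suc (b ▹ x) m))) (grid (suc x) (suc m) j<ℓ))
          (grid x m (ℕ.<⇒≤ j<ℓ))
          (Face.capped (b ▹ x ▹ m) (+ x) j<ℓ)))
        (eq (f (suc x) (suc j)) (f x j) (g m j) (g (suc m) (suc j)))
        where
        eq : ∀ a b c d → c - d - (a - b) ≡ b + c - (a + d)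
        eq = solve-∀

      K : ℕ → ℤ
      K j = proj₁ (supremum n′ λ x → f (suc x) (suc j) - f x j)

      offset : ℕ → ℤ
      offset zero    = 0ℤ
      offset (suc j) = offset j - K j

      -- A potential that no step of a loop can raise by more than the step costs.
      ψ : ℕ → ℕ → ℤ
      ψ x j = f x j + offset j

      -- Late enough that each vertex at time `t` and position `x ≤ n` has the form required by
      -- `grid`, with `m = n ∸ x`.
      t = b ▹ n

      now : ∀ {x} → x ℕ.< n → t ≡ b ▹ x ▹ (n ℕ.∸ x)
      now {x} x<n = sym (trans (▹-▹ b x (n ℕ.∸ x)) (cong (b ▹_) (ℕ.m∸n+n≡m (ℕ.<⇒≤ x<n))))

      ψ-up : ∀ {x} → x ℕ.< n → ∀ {j} → suc j ℕ.< ℓ →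
             ψ x j ≤ ψ x (suc j) + (q t (+ x) j - q (ℤ.suc t) (+ x) (suc j))
      ψ-up {x} x<n {j} j<ℓ with supremum n′ (λ x → f (suc x) (suc j) - f x j)
      ... | s , _ , y , _ , s≡ = by-difference
        (diff (ℤ.≤-trans (ℤ.≤-reflexive s≡) (order y (n ℕ.∸ x) j<ℓ)))
        (trans
          (cong₂ (λ z z′ → f x (suc j) + (offset j - s) + (z - z′) - (f x j + offset j))
            (trans (cong (λ s → q s (+ x) j) (now x<n)) (grid x (n ℕ.∸ x) (ℕ.<⇒≤ j<ℓ)))
            (trans (cong (λ s → q (ℤ.suc s) (+ x) (suc j)) (now x<n)) (grid x (suc (n ℕ.∸ x)) j<ℓ)))
          (eq (f x (suc j)) (offset j) s (f x j) (g (n ℕ.∸ x) j) (g (suc (n ℕ.∸ x)) (suc j))))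
        where
        eq : ∀ a o s c d e → a + (o - s) + (c + d - (a + e)) - (c + o) ≡ d - e - s
        eq = solve-∀

      ψ-stay : ∀ {x} → x ℕ.< n → ∀ {j} → j ℕ.< ℓ →
               ψ (suc x) j ≤ ψ x j + (q (ℤ.suc t) (+ suc x) j - q t (+ x) j)
      ψ-stay {x} x<n {j} j<ℓ = ℤ.≤-reflexive (trans
        (eq (f (suc x) j) (offset j) (f x j) (g (n ℕ.∸ x) j))
        (sym (cong₂ (λ z z′ → f x j + offset j + (z - z′))
          (trans (cong (λ s → q s (+ suc x) j)
              (trans (cong ℤ.suc (now x<n)) (sym (▹-suc (b ▹ x) (n ℕ.∸ x)))))
            (grid (suc x) (n ℕ.∸ x) j<ℓ))
          (trans (cong (λ s → q s (+ x) j) (now x<n)) (grid x (n ℕ.∸ x) j<ℓ)))))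
        where
        eq : ∀ a o c d → a + o ≡ c + o + (a + d - (c + d))
        eq = solve-∀

      ψ-down : ∀ {x} → x ℕ.< n → ∀ {j} → suc j ℕ.< ℓ → ψ (suc x) (suc j) ≤ ψ x j
      ψ-down {x} x<n {j} j<ℓ = by-difference
        (diff (proj₁ (proj₂ (supremum n′ λ x → f (suc x) (suc j) - f x j)) x<n))
        (eq (f (suc x) (suc j)) (offset j) (K j) (f x j))
        where
        eq : ∀ a o s c → c + o - (a + (o - s)) ≡ s - (a - c)
        eq = solve-∀

      ψ-turn : ∀ j → j ℕ.< ℓ → ψ n j ≡ ψ 0 j + v j
      ψ-turn j j<ℓ = trans (eq (f n j) (f 0 j) (offset j))
        (cong (λ z → ψ 0 j + z) (trans
          (cong (λ z → z - f 0 j) (trans (cong (λ x → q t x j) (sym (0▹ n))) (periodic▹ t 0ℤ j)))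
          (steady T≤b 0ℤ j<ℓ)))
        where
        eq : ∀ a b o → a + o ≡ b + o + (a - b)
        eq = solve-∀

    -- Once around, the potential of the particles rises by at most the cost. As the loop is closed,
    -- by `ψ-turn` the rise is `total v (P 0)`, which is at least the sum of the `k` smallest
    -- speeds.
    loop-cost : ∀ {k w} → Loop (b ▹ n) k w → ∑ k (λ j → v (ℓ ℕ.∸ suc j)) ≤ w
    loop-cost {k} {w} L = ℤ.≤-trans
      (subst (λ k → ∑ k (λ j → v (ℓ ℕ.∸ suc j)) ≤ total v (P 0)) size
        (smallest-total v-antitone ℕ.≤-refl (P-descends 0)))
      (ℤ.≤-trans (by-difference (diff (around n ℕ.≤-refl))
        (trans (eq (total (ψ 0) (P 0)) (∑ n (λ x → r x + a x)) (total v (P 0)))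
          (cong (λ z → total (ψ 0) (P 0) + ∑ n (λ x → r x + a x) - z) (sym
            (trans (cong (total (ψ n)) closed) (total-cong (λ {j} → ψ-turn j) (P-descends 0))))))) cost)
      where
      open Loop L

      eq : ∀ a b c → b - c ≡ a + b - (a + c)
      eq = solve-∀

      around : ∀ m → m ℕ.≤ n → total (ψ m) (P m) ≤ total (ψ 0) (P 0) + ∑ m (λ x → r x + a x)
      around zero    _   = ℤ.≤-reflexive (sym (ℤ.+-identityʳ _))
      around (suc m) m<n = by-difference
        (diff (around m (ℕ.<⇒≤ m<n))
         ⊞ diff (total-retreat (ψ m) (ψ-up m<n) (retreats m) (P-descends m))
         ⊞ diff (total-advance (ψ m) (ψ (suc m)) (ψ-stay m<n) (ψ-down m<n) (advances m) (P-descends (suc m))))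
        (eq′ (total (ψ 0) (P 0)) (∑ m (λ x → r x + a x)) (total (ψ m) (P m)) (total (ψ m) (J m)) (r m) (a m) (total (ψ (suc m)) (P (suc m))))
        where
        eq′ : ∀ p s p′ j r a p″ → p + (s + (r + a)) - p″ ≡ p + s - p′ + (p′ + r - j) + (j + a - p″)
        eq′ = solve-∀

  -- The loop standing on the top k rows at an early time can be pushed into the settled
  -- regime at no extra cost.
  slowest-speeds : ∀ {T v} → Settled F T v → ∀ t {k} → k ℕ.≤ ℓ →
    ∑ k (λ j → v (ℓ ℕ.∸ suc j)) ≤ ∑ n (λ x → ∑ k (λ j → q (ℤ.suc t) (+ suc x) j - q t (+ x) j))
  slowest-speeds {T} S t {k} k≤ℓ = Settle.loop-cost S T≤b
    (subst (λ s → Loop s k _) (sym (▹-▹ t m n)) (push▹ (n ℕ.+ m) (standing t k k≤ℓ)))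
    where
    m = ∣ T - t ∣
    T≤b : T ≤ t ▹ m
    T≤b = subst (T ≤_) (sym (▹-+ t m)) (by-difference (diff (i≤+∣i∣ (T - t))) (eq T t (+ m)))
      where
      eq : ∀ T t m → t + m - T ≡ m - (T - t)
      eq = solve-∀

-- Reversing time

-- The sign makes the rows grow again when time runs backwards; it also inverts their order, which
-- the reversed index repairs.
mirror : ℕ → (ℕ → ℤ) → ℕ → ℤ
mirror ℓ f j = - f (ℓ ℕ.∸ suc j)

suc-∸-suc : ∀ {j ℓ} → j ℕ.< ℓ → suc (ℓ ℕ.∸ suc j) ≡ ℓ ℕ.∸ j
suc-∸-suc j<ℓ = sym (ℕ.+-∸-assoc 1 j<ℓ)

∸-suc-< : ∀ {j ℓ} → j ℕ.< ℓ → ℓ ℕ.∸ suc j ℕ.< ℓ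
∸-suc-< {j} {ℓ} j<ℓ = subst (ℕ._≤ ℓ) (sym (suc-∸-suc j<ℓ)) (ℕ.m∸n≤m ℓ j)

mirror-index : ∀ {j ℓ} → j ℕ.< ℓ → ℓ ℕ.∸ suc (ℓ ℕ.∸ suc j) ≡ j
mirror-index {j} {ℓ} j<ℓ = trans (cong (ℓ ℕ.∸_) (suc-∸-suc j<ℓ)) (ℕ.m∸[m∸n]≡n (ℕ.<⇒≤ j<ℓ))

-- A half-turn of the square exchanges κ with ν and μ with ρ. Inequalities between ν in one row and
-- κ in the row above survive because sign and row order are reversed together.
mirror-law : ∀ {ℓ κ μ ρ ν C} → GrowthLaw ℓ κ μ ρ ν C →
  GrowthLaw ℓ (mirror ℓ ν) (mirror ℓ ρ) (mirror ℓ μ) (mirror ℓ κ) (λ k → C (ℓ ℕ.∸ k))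
mirror-law {ℓ} {κ} {μ} {ρ} {ν} {C} G = record
  { C-nonNeg = λ k → C-nonNeg (ℓ ℕ.∸ k)
  ; C-first  = C-last
  ; C-last   = trans (cong C (ℕ.n∸n≡0 ℓ)) C-first
  ; law      = λ {j} j<ℓ → trans (solved (κ (ℓ ℕ.∸ suc j)) (μ (ℓ ℕ.∸ suc j)) (ρ (ℓ ℕ.∸ suc j)) (law (∸-suc-< j<ℓ)))
      (cong (λ k → - ρ (ℓ ℕ.∸ suc j) + - μ (ℓ ℕ.∸ suc j) - - ν (ℓ ℕ.∸ suc j) + C (ℓ ℕ.∸ suc j) - C k) (suc-∸-suc j<ℓ))
  ; capped   = λ {j} j<ℓ → ℤ.neg-mono-≤ (subst (λ i → ν i ≤ κ (ℓ ℕ.∸ suc (suc j))) (suc-∸-suc j<ℓ) (capped (inside j<ℓ)))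
  ; full     = λ {j} j<ℓ C≢0 → cong -_ (sym (trans (cong ν (sym (suc-∸-suc j<ℓ)))
      (full (inside j<ℓ) (λ C≡0 → C≢0 (trans (cong C (sym (suc-∸-suc j<ℓ))) C≡0)))))
  }
  where
  open GrowthLaw G
  inside : ∀ {j} → suc j ℕ.< ℓ → suc (ℓ ℕ.∸ suc (suc j)) ℕ.< ℓ
  inside j<ℓ = subst (ℕ._< ℓ) (sym (suc-∸-suc j<ℓ)) (∸-suc-< (ℕ.<⇒≤ j<ℓ))
  solved : ∀ k m p {n c c′} → n ≡ m + p - k + c - c′ → - k ≡ - p + - m - - n + c′ - c
  solved k m p {c = c} {c′} refl = eq k m p c c′
    where
    eq : ∀ k m p c c′ → - k ≡ - p + - m - - (m + p - k + c - c′) + c′ - c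
    eq = solve-∀

-suc : ∀ t → - t ≡ ℤ.suc (- ℤ.suc t)
-suc = eq
  where
  eq : ∀ t → - t ≡ 1ℤ + - (1ℤ + t)
  eq = solve-∀

reverse : ∀ {n ℓ} → Rows n ℓ → Rows n ℓ
reverse {n} {ℓ} F = record
  { q        = λ t x → mirror ℓ (q (- t) (- x))
  ; C        = λ t x k → C (- ℤ.suc (ℤ.suc t)) (- ℤ.suc x) (ℓ ℕ.∸ k)
  ; periodic = λ t x m j → cong -_ (trans
      (cong (λ x → q (- t) x (ℓ ℕ.∸ suc j)) (shift x m (+ n))) (periodic (- t) (- x) (- m) (ℓ ℕ.∸ suc j)))
  ; mono₁    = λ t x {j} j<ℓ → ℤ.neg-mono-≤
      (subst₂ (λ t′ x′ → q (- ℤ.suc t) (- ℤ.suc x) (ℓ ℕ.∸ suc j) ≤ q t′ x′ (ℓ ℕ.∸ suc j))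
        (sym (-suc t)) (sym (-suc x)) (mono₁ (- ℤ.suc t) (- ℤ.suc x) (∸-suc-< j<ℓ)))
  ; mono₂    = λ t x {j} j<ℓ → ℤ.neg-mono-≤
      (subst (λ t′ → q (- ℤ.suc t) (- x) (ℓ ℕ.∸ suc j) ≤ q t′ (- x) (ℓ ℕ.∸ suc j))
        (sym (-suc t)) (mono₂ (- ℤ.suc t) (- x) (∸-suc-< j<ℓ)))
  ; face     = λ t x → turned (- ℤ.suc (ℤ.suc t)) (- ℤ.suc x) (-suc (ℤ.suc t)) (-suc t) (-suc x)
  }
  where
  open Rows F
  shift : ∀ x m n → - (x + m * n) ≡ - x + - m * n
  shift = solve-∀
  -- Negation and successor do not commute by computation, so the coordinates of the corners are
  -- abstracted and then identified by matching.
  turned : ∀ t₀ x₀ {t₁ t₂ x₁} → t₁ ≡ ℤ.suc t₀ → t₂ ≡ ℤ.suc t₁ → x₁ ≡ ℤ.suc x₀ →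
    GrowthLaw ℓ (mirror ℓ (q t₂ x₁)) (mirror ℓ (q t₁ x₀)) (mirror ℓ (q t₁ x₁)) (mirror ℓ (q t₀ x₀))
                (λ k → C t₀ x₀ (ℓ ℕ.∸ k))
  turned t₀ x₀ refl refl refl = mirror-law (face t₀ x₀)

module _ {n ℓ : ℕ} (F : Rows n ℓ) where
  open RowsProperties F
  private
    module R  = RowsProperties (reverse F)
    module RR = RowsProperties (reverse (reverse F))

    twice : ∀ t → - ℤ.suc (ℤ.suc (- ℤ.suc (ℤ.suc t))) ≡ t
    twice = eq
      where
      eq : ∀ t → - (1ℤ + (1ℤ + - (1ℤ + (1ℤ + t)))) ≡ t
      eq = solve-∀

    twice′ : ∀ x → - ℤ.suc (- ℤ.suc x) ≡ x
    twice′ = eq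
      where
      eq : ∀ x → - (1ℤ + - (1ℤ + x)) ≡ x
      eq = solve-∀

  reverse-free : ∀ {t} → R.Free (- ℤ.suc (ℤ.suc t)) → Free t
  reverse-free {t} free x {k} k≤ℓ = trans
    (sym (trans (cong₂ (λ t x → C t x (ℓ ℕ.∸ (ℓ ℕ.∸ k))) (twice t) (twice′ x)) (cong (C t x) (ℕ.m∸[m∸n]≡n k≤ℓ))))
    (free (- ℤ.suc x) (ℕ.m∸n≤m ℓ k))

  reverse-speed : ∀ t x {j} → R.speed (- (t ▹ n)) (- x) j ≡ speed t x (ℓ ℕ.∸ suc j)
  reverse-speed t x {j} = trans
    (cong₂ (λ a b → - a - - b)
      (cong₂ (λ t x → q t x (ℓ ℕ.∸ suc j)) time (ℤ.neg-involutive x))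
      (cong₂ (λ t x → q t x (ℓ ℕ.∸ suc j)) (ℤ.neg-involutive (t ▹ n)) (ℤ.neg-involutive x)))
    (eq (q t x (ℓ ℕ.∸ suc j)) (q (t ▹ n) x (ℓ ℕ.∸ suc j)))
    where
    eq : ∀ a b → - a - - b ≡ b - a
    eq = solve-∀
    time : - (- (t ▹ n) ▹ n) ≡ t
    time = trans (cong -_ (▹-+ (- (t ▹ n)) n))
      (trans (cong (λ s → - (- s + + n)) (▹-+ t n)) (eq′ t (+ n)))
      where
      eq′ : ∀ t n → - (- (t + n) + n) ≡ t
      eq′ = solve-∀

  -- The double reversal returns `F` only pointwise, and only on rows below `ℓ`, so the settled
  -- regime is carried over field by field.
  reverse-reverse : ∀ {T v} → Settled F T v → Settled (reverse (reverse F)) T v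
  reverse-reverse {T} S = record
    { free       = λ {t} T≤t x {k} k≤ℓ → trans
        (cong₂ (λ t x → C t x (ℓ ℕ.∸ (ℓ ℕ.∸ k))) (twice t) (twice′ x))
        (trans (cong (C t x) (ℕ.m∸[m∸n]≡n k≤ℓ)) (free T≤t x k≤ℓ))
    ; steady     = λ {t} T≤t x j<ℓ → trans
        (cong₂ _-_ (same (t ▹ n) x j<ℓ) (same t x j<ℓ)) (steady T≤t x j<ℓ)
    ; v-antitone = v-antitone
    }
    where
    open Settled S
    same : ∀ t x {j} → j ℕ.< ℓ → RR.q t x j ≡ q t x j
    same t x {j} j<ℓ = trans (ℤ.neg-involutive _) (trans
      (cong₂ (λ t x → q t x (ℓ ℕ.∸ suc (ℓ ℕ.∸ suc j))) (ℤ.neg-involutive t) (ℤ.neg-involutive x))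
      (cong (q t x) (mirror-index j<ℓ)))

-- Comparison of the speeds of past and future.

module _ {n′ ℓ : ℕ} where
  private
    n = suc n′

  speeds-≤ : ∀ (F : Rows n ℓ) {T T⁻ v u} → Settled F T v → Settled (reverse F) T⁻ u →
    ∀ {k} → k ℕ.≤ ℓ → ∑ k (λ j → v (ℓ ℕ.∸ suc j)) ≤ ∑ k (λ j → u (ℓ ℕ.∸ suc j))
  speeds-≤ F {T⁻ = T⁻} {u = u} S S⁻ {k} k≤ℓ = ℤ.≤-trans (Loops.slowest-speeds F S t k≤ℓ)
    (ℤ.≤-reflexive (trans (∑-swap n k _) (∑-cong k λ j<k → row-cost (ℕ.≤-trans j<k k≤ℓ))))
    where
    open RowsProperties F
    open Settled S⁻

    -- The square at time `t` is the reversed square at time `-t - 2`, whence the 2; the `n` puts a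
    -- whole period after `t` into the settled past.
    t = - (T⁻ ▹ (2 ℕ.+ n))

    early : ∀ {i} → i ℕ.< n → Free (t ▹ i)
    early {i} i<n = reverse-free F (free (subst (T⁻ ≤_)
      (sym (trans (cong (λ s → - (1ℤ + (1ℤ + s))) (▹-+ t i))
        (trans (cong (λ s → - (1ℤ + (1ℤ + (- s + + i)))) (▹-+ T⁻ (2 ℕ.+ n)))
          (eq T⁻ (+ n) (+ i)))))
      (by-difference (diff (ℤ.+≤+ (ℕ.<⇒≤ i<n))) (eq′ T⁻ (+ n - + i)))))
      where
      eq : ∀ T n i → - (1ℤ + (1ℤ + (- (T + (1ℤ + (1ℤ + n))) + i))) ≡ T + (n - i)
      eq = solve-∀
      eq′ : ∀ T d → T + d - T ≡ d
      eq′ = solve-∀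

    late : T⁻ ≤ - (t ▹ n)
    late = by-difference (ℤ.+≤+ z≤n)
      (trans (cong (λ s → - s - T⁻) (trans (▹-+ t n) (cong (λ s → - s + + n) (▹-+ T⁻ (2 ℕ.+ n)))))
        (eq T⁻ (+ n)))
      where
      eq : ∀ T n → - (- (T + (1ℤ + (1ℤ + n))) + n) - T ≡ 1ℤ + 1ℤ
      eq = solve-∀

    -- In the settled past `along₂` moves each increment in time without change, onto one diagonal.
    -- There the sum telescopes to the advance during one turn, which is the speed of the row.
    row-cost : ∀ {j} → j ℕ.< ℓ →
      ∑ n (λ x → q (ℤ.suc t) (+ suc x) j - q t (+ x) j) ≡ u (ℓ ℕ.∸ suc j)
    row-cost {j} j<ℓ = trans
      (∑-cong n λ {x} x<n → sym (trans (RowWave.along₂ j<ℓ t (+ x) x)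
        (trans (cong (λ z → q (ℤ.suc t) (+ suc x) j - q t (+ x) j + z)
          (∑-zero x λ i<x → cong₂ _-_ (early (ℕ.<-trans i<x x<n) _ j<ℓ) (early (ℕ.<-trans i<x x<n) _ (ℕ.<⇒≤ j<ℓ))))
          (ℤ.+-identityʳ _))))
      (trans (∑-telescope n (λ x → q (t ▹ x) (+ x) j))
      (trans (cong (λ z → z - q t 0ℤ j) (trans (cong (λ x → q (t ▹ n) x j) (sym (0▹ n))) (periodic▹ (t ▹ n) 0ℤ j)))
      (trans (cong (speed t 0ℤ) (sym (mirror-index j<ℓ)))
      (trans (sym (reverse-speed F t 0ℤ)) (steady late 0ℤ (∸-suc-< j<ℓ))))))

  ∑-injective : ∀ {m} {f g : ℕ → ℤ} → (∀ {k} → k ℕ.≤ m → ∑ k f ≡ ∑ k g) → ∀ {j} → j ℕ.< m → f j ≡ g j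
  ∑-injective {f = f} {g} same {j} j<m = trans (eq (∑ j f) (f j))
    (trans (cong₂ _-_ (same j<m) (same (ℕ.<⇒≤ j<m))) (sym (eq (∑ j g) (g j))))
    where
    eq : ∀ s a → a ≡ s + a - s
    eq = solve-∀

  -- Applied to the reversed rows, `speeds-≤` exchanges `v` and `u`. So all sums of smallest speeds
  -- agree, and their differences are the single speeds.
  speeds-agree : ∀ (F : Rows n ℓ) {T T⁻ v u} → Settled F T v → Settled (reverse F) T⁻ u →
    ∀ {j} → j ℕ.< ℓ → v j ≡ u j
  speeds-agree F {v = v} {u} S S⁻ {j} j<ℓ = subst (λ i → v i ≡ u i) (mirror-index j<ℓ)
    (∑-injective {f = λ j → v (ℓ ℕ.∸ suc j)} {λ j → u (ℓ ℕ.∸ suc j)}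
      (λ k≤ℓ → ℤ.≤-antisym (speeds-≤ F S S⁻ k≤ℓ)
                           (speeds-≤ (reverse F) S⁻ (reverse-reverse F S) k≤ℓ))
      (∸-suc-< j<ℓ))

-- From conjugates to rows

nth : ∀ {ℓ} → Vec ℤ ℓ → ℕ → ℤ
nth []      _       = 0ℤ
nth (x ∷ v) zero    = x
nth (x ∷ v) (suc j) = nth v j

nth-lookup : ∀ {ℓ} (v : Vec ℤ ℓ) {j} (j<ℓ : j ℕ.< ℓ) → lookup v (fromℕ< j<ℓ) ≡ nth v j
nth-lookup (x ∷ v) {zero}  _         = refl
nth-lookup (x ∷ v) {suc j} (s≤s j<ℓ) = nth-lookup v j<ℓ

nth-head : ∀ {ℓ} {v : Vec ℤ ℓ} → Linked ℤ._≥_ v → ∀ {j} → j ℕ.< ℓ → nth v j ≤ nth v 0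
nth-head [-]       {zero}  _         = ℤ.≤-refl
nth-head [-]       {suc j} (s≤s ())
nth-head (_ ∷ _)   {zero}  _         = ℤ.≤-refl
nth-head {v = _ ∷ _ ∷ _} (x≥y ∷ d) {suc j} (s≤s j<ℓ) = ℤ.≤-trans (nth-head d j<ℓ) x≥y

nth-tail : ∀ {ℓ x} {v : Vec ℤ ℓ} → Linked ℤ._≥_ (x ∷ v) → Linked ℤ._≥_ v
nth-tail [-]     = []
nth-tail (_ ∷ d) = d

nth-antitone : ∀ {ℓ} {v : Vec ℤ ℓ} → Linked ℤ._≥_ v → ∀ {j} → suc j ℕ.< ℓ → nth v (suc j) ≤ nth v j
nth-antitone d {zero}  j<ℓ = nth-head d j<ℓ
nth-antitone {v = _ ∷ _} d {suc j} (s≤s j<ℓ) = nth-antitone (nth-tail d) j<ℓ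

-- With `count-<` this is the adjunction between a signature and its conjugate.
<-count : ∀ {ℓ z} {v : Vec ℤ ℓ} → Linked ℤ._≥_ v → ∀ {j} → j ℕ.< ℓ → z ≤ nth v j → j ℕ.< count (z ℤ.≤?_) v
<-count {z = z} {x ∷ v} d {j} j<ℓ z≤ with z ℤ.≤? x
... | no z≰x = ⊥-elim (z≰x (ℤ.≤-trans z≤ (nth-head d j<ℓ)))
<-count {v = x ∷ v} d {zero}  _         z≤ | yes _ = s≤s z≤n
<-count {v = x ∷ v} d {suc j} (s≤s j<ℓ) z≤ | yes _ = s≤s (<-count (nth-tail d) j<ℓ z≤)

count-< : ∀ {ℓ z} {v : Vec ℤ ℓ} → Linked ℤ._≥_ v → ∀ {j} → j ℕ.< count (z ℤ.≤?_) v → z ≤ nth v j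
count-< {z = z} {x ∷ v} d {j} j< with z ℤ.≤? x
... | no z≰x = ⊥-elim (z≰x (ℤ.≤-trans (count-< (nth-tail d) j<)
                 (nth-head d (s≤s (ℕ.≤-trans j< (Vec.count≤n (z ℤ.≤?_) v))))))
count-< {v = x ∷ v} d {zero}  j<       | yes z≤x = z≤x
count-< {v = x ∷ v} d {suc j} (s≤s j<) | yes z≤x = count-< (nth-tail d) j<

indicator : ℤ → ℤ → ℤ
indicator z y = if does (z ℤ.≤? y) then 1ℤ else 0ℤ

count-indicator : ∀ {ℓ} z (v : Vec ℤ ℓ) → + count (z ℤ.≤?_) v ≡ ∑ ℓ (λ j → indicator z (nth v j))
count-indicator z [] = refl
count-indicator {suc ℓ} z (x ∷ v) = trans (first x) (sym (∑-suc ℓ (λ j → indicator z (nth (x ∷ v) j))))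
  where
  first : ∀ x → + count (z ℤ.≤?_) (x ∷ v) ≡ indicator z x + ∑ ℓ (λ j → indicator z (nth v j))
  first x with z ℤ.≤? x
  ... | yes _ = cong (λ s → 1ℤ + s) (count-indicator z v)
  ... | no  _ = trans (count-indicator z v) (sym (ℤ.+-identityˡ _))

indicator-1 : ∀ {z y} → z ≤ y → indicator z y ≡ 1ℤ
indicator-1 {z} {y} z≤y with z ℤ.≤? y
... | yes _  = refl
... | no z≰y = ⊥-elim (z≰y z≤y)

indicator-0 : ∀ {z y} → y < z → indicator z y ≡ 0ℤ
indicator-0 {z} {y} y<z with z ℤ.≤? y
... | yes z≤y = ⊥-elim (ℤ.<⇒≱ y<z z≤y)
... | no  _   = refl

▹-≤ : ∀ t m → t ≤ t ▹ m
▹-≤ t zero    = ℤ.≤-refl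
▹-≤ t (suc m) = ℤ.≤-trans (▹-≤ t m) (ℤ.i≤suc[i] (t ▹ m))

-- The number of columns among the `M` columns after `Y` that a row ending at `y` reaches.
above : ℤ → ℕ → ℤ → ℤ
above Y M y = ∑ M (λ m → indicator (Y ▹ suc m) y)

above-low : ∀ {Y y} M → y ≤ Y → above Y M y ≡ 0ℤ
above-low {Y} M y≤Y = ∑-zero M λ {m} _ →
  indicator-0 (ℤ.suc[i]≤j⇒i<j (ℤ.suc-mono (ℤ.≤-trans y≤Y (▹-≤ Y m))))

above-high : ∀ {Y y} M → Y ≤ y → y ≤ Y ▹ M → above Y M y ≡ y - Y
above-high zero    Y≤y y≤ = sym (ℤ.i≡j⇒i-j≡0 (ℤ.≤-antisym y≤ Y≤y))
above-high {Y} {y} (suc M) Y≤y y≤ with y ℤ.≤? Y ▹ M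
... | yes y≤′ = trans (cong₂ _+_ (above-high M Y≤y y≤′) (indicator-0 (ℤ.suc[i]≤j⇒i<j (ℤ.suc-mono y≤′))))
                      (ℤ.+-identityʳ (y - Y))
... | no  y≰  = trans (cong₂ _+_ (full M (ℤ.≤-trans (ℤ.i≤suc[i] _) top)) (indicator-1 top))
  (trans (eq (Y ▹ M) Y) (cong (λ z → z - Y) (ℤ.≤-antisym top y≤)))
  where
  top : Y ▹ suc M ≤ y
  top = ℤ.i<j⇒suc[i]≤j (ℤ.≰⇒> y≰)
  eq : ∀ a Y → a - Y + 1ℤ ≡ 1ℤ + a - Y
  eq = solve-∀
  full : ∀ M → Y ▹ M ≤ y → above Y M y ≡ Y ▹ M - Y
  full zero    _ = sym (ℤ.+-inverseʳ Y)
  full (suc M) Y≤ = trans (cong₂ _+_ (full M (ℤ.≤-trans (ℤ.i≤suc[i] _) Y≤)) (indicator-1 Y≤)) (eq (Y ▹ M) Y)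

∑-truncate : ∀ {k m} {f : ℕ → ℤ} → k ℕ.≤ m → (∀ {j} → k ℕ.≤ j → j ℕ.< m → f j ≡ 0ℤ) → ∑ m f ≡ ∑ k f
∑-truncate {k} {zero}  z≤n f≡0 = refl
∑-truncate {k} {suc m} {f} k≤ f≡0 with k ℕ.≟ suc m
... | yes refl = refl
... | no  k≢   = trans (cong₂ _+_ (∑-truncate k≤m λ k≤j j<m → f≡0 k≤j (ℕ.m<n⇒m<1+n j<m)) (f≡0 k≤m ℕ.≤-refl))
                       (ℤ.+-identityʳ _)
  where k≤m = ℕ.≤-pred (ℕ.≤∧≢⇒< k≤ k≢)

nth-≤ : ∀ {ℓ} (κ μ : Signature ℓ) → κ ⪯ μ → ∀ {j} → j ℕ.< ℓ → nth (entries κ) j ≤ nth (entries μ) j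
nth-≤ κ μ κ⪯μ j<ℓ = subst₂ _≤_ (nth-lookup (entries κ) j<ℓ) (nth-lookup (entries μ) j<ℓ)
  (proj₁ κ⪯μ (fromℕ< j<ℓ))

module Carrier {ℓ} {κ μ ρ ν : Signature ℓ} (κ⪯μ : κ ⪯ μ) (κ⪯ρ : κ ⪯ ρ) (μ⪯ν : μ ⪯ ν) (ρ⪯ν : ρ ⪯ ν)
               (grown : IsGrowth κ μ ρ ν) where
  private
    c = proj₁ grown
    open IsCarrier (proj₁ (proj₂ grown))

    row : Signature ℓ → ℕ → ℤ
    row σ = nth (entries σ)

    supply : ℤ → ℤ
    supply z = (conj μ (ℤ.suc z) - conj κ (ℤ.suc z)) + (conj ρ (ℤ.suc z) - conj κ (ℤ.suc z)) + c z - 1ℤ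

    back : ∀ z → ℤ.suc z - 1ℤ ≡ z
    back = eq
      where
      eq : ∀ z → 1ℤ + z - 1ℤ ≡ z
      eq = solve-∀

    c-suc : ∀ z → c (ℤ.suc z) ≡ 0ℤ ⊔ supply z
    c-suc z = trans (recursion (ℤ.suc z))
      (cong (λ y → 0ℤ ⊔ ((conj μ (ℤ.suc z) - conj κ (ℤ.suc z)) + (conj ρ (ℤ.suc z) - conj κ (ℤ.suc z)) + c y - 1ℤ)) (back z))

    conj-suc : ∀ z → conj ν (ℤ.suc z) ≡ conj μ (ℤ.suc z) + conj ρ (ℤ.suc z) - conj κ (ℤ.suc z) + c z - c (ℤ.suc z)
    conj-suc z = trans (proj₂ (proj₂ grown) (ℤ.suc z))
      (cong (λ y → conj μ (ℤ.suc z) + conj ρ (ℤ.suc z) - conj κ (ℤ.suc z) + c y - c (ℤ.suc z)) (back z))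

    unsuc : ∀ z → ℤ.suc (ℤ.pred z) ≡ z
    unsuc = ℤ.suc-pred

    c-nonNeg : ∀ z → 0ℤ ≤ c z
    c-nonNeg z = subst (0ℤ ≤_) (sym (recursion z)) (ℤ.i≤i⊔j 0ℤ _)

    conj-≤ : ∀ z → conj ν z ≤ conj κ z + 1ℤ
    conj-≤ z = subst (λ z → conj ν z ≤ conj κ z + 1ℤ) (unsuc z) (at-suc (ℤ.pred z))
      where
      at-suc : ∀ z → conj ν (ℤ.suc z) ≤ conj κ (ℤ.suc z) + 1ℤ
      at-suc z = by-difference (diff (ℤ.≤-trans (ℤ.i≤j⊔i 0ℤ (supply z)) (ℤ.≤-reflexive (sym (c-suc z)))))
        (trans (cong (λ n → conj κ (ℤ.suc z) + 1ℤ - n) (conj-suc z))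
          (eq (conj μ (ℤ.suc z)) (conj ρ (ℤ.suc z)) (conj κ (ℤ.suc z)) (c z) (c (ℤ.suc z))))
        where
        eq : ∀ m p k c⁻ c → k + 1ℤ - (m + p - k + c⁻ - c) ≡ c - ((m - k) + (p - k) + c⁻ - 1ℤ)
        eq = solve-∀

    -- A nonzero carry means that the maximum is its second argument; then the column keeps just
    -- enough to exceed κ by one, and the rest moves on.
    conj-≡ : ∀ z → c z ≢ 0ℤ → conj ν z ≡ conj κ z + 1ℤ
    conj-≡ z = subst (λ z → c z ≢ 0ℤ → conj ν z ≡ conj κ z + 1ℤ) (unsuc z) (at-suc (ℤ.pred z))
      where
      eq : ∀ m p k c⁻ → m + p - k + c⁻ - ((m - k) + (p - k) + c⁻ - 1ℤ) ≡ k + 1ℤ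
      eq = solve-∀
      at-suc : ∀ z → c (ℤ.suc z) ≢ 0ℤ → conj ν (ℤ.suc z) ≡ conj κ (ℤ.suc z) + 1ℤ
      at-suc z c≢0 with ℤ.⊔-sel 0ℤ (supply z)
      ... | inj₁ ⊔≡0 = ⊥-elim (c≢0 (trans (c-suc z) ⊔≡0))
      ... | inj₂ ⊔≡s = trans (conj-suc z)
        (trans (cong (λ y → conj μ (ℤ.suc z) + conj ρ (ℤ.suc z) - conj κ (ℤ.suc z) + c z - y) (trans (c-suc z) ⊔≡s))
          (eq (conj μ (ℤ.suc z)) (conj ρ (ℤ.suc z)) (conj κ (ℤ.suc z)) (c z)))

    κ≤μ : ∀ {j} → j ℕ.< ℓ → row κ j ≤ row μ j
    κ≤μ = nth-≤ κ μ κ⪯μ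

    κ≤ρ : ∀ {j} → j ℕ.< ℓ → row κ j ≤ row ρ j
    κ≤ρ = nth-≤ κ ρ κ⪯ρ

    μ≤ν : ∀ {j} → j ℕ.< ℓ → row μ j ≤ row ν j
    μ≤ν = nth-≤ μ ν μ⪯ν

    ρ≤ν : ∀ {j} → j ℕ.< ℓ → row ρ j ≤ row ν j
    ρ≤ν = nth-≤ ρ ν ρ⪯ν

    box : ℕ → ℤ
    box j = row ν j - row μ j - row ρ j + row κ j

    -- Count the boxes to the right of column Y column by column: there c telescopes.
    heads : ∀ {Y k} → k ℕ.≤ ℓ → (∀ {j} → j ℕ.< k → Y ≤ row κ j) →
            (∀ {j} → k ℕ.≤ j → j ℕ.< ℓ → row ν j ≤ Y) → ∑ k box ≡ c Y
    heads {Y} {k} k≤ℓ high low = trans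
      (sym (trans (∑-truncate k≤ℓ λ k≤j j<ℓ → four-low k≤j j<ℓ)
                  (∑-cong k λ j<k → four-high j<k)))
      (trans (split-rows M) (trans (cong (λ z → c Y - z) c-top) (ℤ.+-identityʳ (c Y))))
      where
      M : ℕ
      M = suc ∣ row ν 0 - Y ∣

      top : row ν 0 < Y ▹ M
      top = ℤ.suc[i]≤j⇒i<j (ℤ.suc-mono (subst (row ν 0 ≤_) (sym (▹-+ Y ∣ row ν 0 - Y ∣))
        (by-difference (diff (i≤+∣i∣ (row ν 0 - Y))) (eq (row ν 0) Y (+ ∣ row ν 0 - Y ∣)))))
        where
        eq : ∀ a Y m → Y + m - a ≡ m - (a - Y)
        eq = solve-∀

      -- `M` was chosen so that this column lies beyond the first row of ν. A carry there would, by
      -- `conj-≡`, put a box of ν into it.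
      c-top : c (Y ▹ M) ≡ 0ℤ
      c-top with c (Y ▹ M) ℤ.≟ 0ℤ
      ... | yes c≡0 = c≡0
      ... | no  c≢0 = ⊥-elim (ℤ.<⇒≱ top (count-< (decreasing ν)
        (ℤ.drop‿+≤+ (subst (1ℤ ≤_) (sym (conj-≡ (Y ▹ M) c≢0)) (ℤ.+-mono-≤ (ℤ.+≤+ z≤n) (ℤ.≤-refl {1ℤ}))))))

      four : (ℤ → ℤ) → ℕ → ℤ
      four f j = f (row ν j) - f (row μ j) - f (row ρ j) + f (row κ j)

      four-∑ : ∀ m (f : ℕ → ℤ → ℤ) j → ∑ m (λ i → four (f i) j) ≡ four (λ y → ∑ m (λ i → f i y)) j
      four-∑ zero    f j = refl
      four-∑ (suc m) f j = trans (cong (λ z → z + four (f m) j) (four-∑ m f j))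
        (eq (s ν) (s μ) (s ρ) (s κ) (f m (row ν j)) (f m (row μ j)) (f m (row ρ j)) (f m (row κ j)))
        where
        s : Signature ℓ → ℤ
        s σ = ∑ m (λ i → f i (row σ j))
        eq : ∀ a b c d a′ b′ c′ d′ → a - b - c + d + (a′ - b′ - c′ + d′) ≡
                                     a + a′ - (b + b′) - (c + c′) + (d + d′)
        eq = solve-∀

      ∑-four : ∀ z → ∑ ℓ (four (indicator z)) ≡ conj ν z - conj μ z - conj ρ z + conj κ z
      ∑-four z = trans (∑-+ ℓ _ _) (cong₂ _+_ (trans (∑-- ℓ _ _) (cong₂ _-_ (trans (∑-- ℓ _ _)
        (cong₂ _-_ (count′ ν) (count′ μ))) (count′ ρ))) (count′ κ))
        where
        count′ : ∀ σ → ∑ ℓ (λ j → indicator z (row σ j)) ≡ conj σ z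
        count′ σ = sym (count-indicator z (entries σ))

      split-rows : ∀ M → ∑ ℓ (four (above Y M)) ≡ c Y - c (Y ▹ M)
      split-rows zero    = trans (∑-zero ℓ λ _ → refl) (sym (ℤ.+-inverseʳ (c Y)))
      split-rows (suc M) = trans (∑-cong ℓ λ {j} _ → sym (four-∑ (suc M) (λ m → indicator (Y ▹ suc m)) j))
        (trans (∑-+ ℓ _ _)
        (trans (cong₂ _+_ (trans (∑-cong ℓ λ {j} _ → four-∑ M (λ m → indicator (Y ▹ suc m)) j) (split-rows M))
                          (trans (∑-four (Y ▹ suc M)) (cong (λ n → n - conj μ z′ - conj ρ z′ + conj κ z′) (conj-suc (Y ▹ M)))))
          (eq (c Y) (c (Y ▹ M)) (conj μ z′) (conj ρ z′) (conj κ z′) (c (Y ▹ suc M)))))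
        where
        z′ = Y ▹ suc M
        eq : ∀ a b m p k d → a - b + (m + p - k + b - d - m - p + k) ≡ a - d
        eq = solve-∀

      κ≤ : ∀ {j} → j ℕ.< ℓ → row κ j ≤ row ν j
      κ≤ j<ℓ = ℤ.≤-trans (κ≤μ j<ℓ) (μ≤ν j<ℓ)

      four-low : ∀ {j} → k ℕ.≤ j → j ℕ.< ℓ → four (above Y M) j ≡ 0ℤ
      four-low k≤j j<ℓ = cong₂ _+_ (cong₂ _-_ (cong₂ _-_
        (above-low M (low k≤j j<ℓ))
        (above-low M (ℤ.≤-trans (μ≤ν j<ℓ) (low k≤j j<ℓ))))
        (above-low M (ℤ.≤-trans (ρ≤ν j<ℓ) (low k≤j j<ℓ))))
        (above-low M (ℤ.≤-trans (κ≤ j<ℓ) (low k≤j j<ℓ)))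

      four-high : ∀ {j} → j ℕ.< k → four (above Y M) j ≡ box j
      four-high {j} j<k = trans
        (cong₂ _+_ (cong₂ _-_ (cong₂ _-_
          (above-high M (ℤ.≤-trans (high j<k) (κ≤ j<ℓ)) ν≤)
          (above-high M (ℤ.≤-trans (high j<k) (κ≤μ j<ℓ)) (ℤ.≤-trans (μ≤ν j<ℓ) ν≤)))
          (above-high M (ℤ.≤-trans (high j<k) (κ≤ρ j<ℓ)) (ℤ.≤-trans (ρ≤ν j<ℓ) ν≤)))
          (above-high M (high j<k) (ℤ.≤-trans (κ≤ j<ℓ) ν≤)))
        (eq (row ν j) (row μ j) (row ρ j) (row κ j) Y)
        where
        j<ℓ = ℕ.≤-trans j<k k≤ℓ
        ν≤ : row ν j ≤ Y ▹ M
        ν≤ = ℤ.≤-trans (nth-head (decreasing ν) j<ℓ) (ℤ.<⇒≤ top)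
        eq : ∀ a b c d Y → a - Y - (b - Y) - (c - Y) + (d - Y) ≡ a - b - c + d
        eq = solve-∀

  -- Row `suc j` of ν ends no later than column `row κ j`; what is carried out of that column has to
  -- go to the rows above.
  C : ℕ → ℤ
  C zero    = 0ℤ
  C (suc j) with suc j ℕ.<? ℓ
  ... | yes _ = c (row κ j)
  ... | no  _ = 0ℤ

  private
    C-inside : ∀ {j} → suc j ℕ.< ℓ → C (suc j) ≡ c (row κ j)
    C-inside {j} j<ℓ with suc j ℕ.<? ℓ
    ... | yes _  = refl
    ... | no j≮ℓ = ⊥-elim (j≮ℓ j<ℓ)

    C-outside : ∀ k → ℓ ℕ.≤ k → C k ≡ 0ℤ
    C-outside zero    _  = refl
    C-outside (suc j) ℓ≤ with suc j ℕ.<? ℓ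
    ... | yes j<ℓ = ⊥-elim (ℕ.<⇒≱ j<ℓ ℓ≤)
    ... | no  _   = refl

    C-nonNeg : ∀ k → 0ℤ ≤ C k
    C-nonNeg zero    = ℤ.≤-refl
    C-nonNeg (suc j) with suc j ℕ.<? ℓ
    ... | yes _ = c-nonNeg (row κ j)
    ... | no  _ = ℤ.≤-refl

    -- In column `row ν (suc j)` the conjugate of ν is at least `j + 2`, so by `conj-≤` that of κ is
    -- at least `j + 1`.
    capped : ∀ {j} → suc j ℕ.< ℓ → row ν (suc j) ≤ row κ j
    capped {j} j<ℓ = count-< (decreasing κ) (ℕ.≤-pred (ℕ.≤-trans
      (<-count (decreasing ν) j<ℓ ℤ.≤-refl)
      (subst (count (row ν (suc j) ℤ.≤?_) (entries ν) ℕ.≤_) (ℕ.+-comm _ 1) (ℤ.drop‿+≤+ (conj-≤ (row ν (suc j)))))))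

    full : ∀ {j} → suc j ℕ.< ℓ → C (suc j) ≢ 0ℤ → row ν (suc j) ≡ row κ j
    full {j} j<ℓ C≢0 = ℤ.≤-antisym (capped j<ℓ) (count-< (decreasing ν)
      (subst (suc j ℕ.<_) (sym (trans (ℤ.+-injective (conj-≡ (row κ j) λ c≡0 → C≢0 (trans (C-inside j<ℓ) c≡0))) (ℕ.+-comm _ 1)))
        (s≤s (<-count (decreasing κ) (ℕ.<⇒≤ j<ℓ) ℤ.≤-refl))))

    C-heads : ∀ {k} → k ℕ.≤ ℓ → ∑ k box ≡ C k
    C-heads {zero}  _   = refl
    C-heads {suc j} j<ℓ with suc j ℕ.≟ ℓ
    ... | no  j≢ℓ = trans (heads j<ℓ
        (λ i≤j → antitone-≤ (nth-antitone (decreasing κ)) (ℕ.≤-pred i≤j) j<ℓ)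
        (λ j<i i<ℓ → ℤ.≤-trans (antitone-≤ (nth-antitone (decreasing ν)) j<i i<ℓ) (capped (ℕ.≤∧≢⇒< j<ℓ j≢ℓ))))
      (sym (C-inside (ℕ.≤∧≢⇒< j<ℓ j≢ℓ)))
    -- For all rows together the dividing column is taken to the left of κ and so far left that no
    -- carry has started.
    ... | yes refl = trans (heads {ℤ._⊓_ (proj₁ vanishesAtLeft) (row κ j)} ℕ.≤-refl
        (λ i≤j → ℤ.≤-trans (ℤ.i⊓j≤j (proj₁ vanishesAtLeft) (row κ j)) (antitone-≤ (nth-antitone (decreasing κ)) (ℕ.≤-pred i≤j) ℕ.≤-refl))
        (λ j<i i<ℓ → ⊥-elim (ℕ.<⇒≱ i<ℓ j<i)))
      (trans (proj₂ vanishesAtLeft _ (ℤ.i⊓j≤i (proj₁ vanishesAtLeft) (row κ j))) (sym (C-outside (suc j) ℕ.≤-refl)))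

  growth-law : GrowthLaw ℓ (row κ) (row μ) (row ρ) (row ν) C
  growth-law = record
    { C-nonNeg = C-nonNeg
    ; C-first  = refl
    ; C-last   = C-outside ℓ ℕ.≤-refl
    ; law      = λ {j} j<ℓ → trans (eq (∑ j box) (row ν j) (row μ j) (row ρ j) (row κ j))
        (cong₂ (λ a b → row μ j + row ρ j - row κ j + a - b) (C-heads j<ℓ) (C-heads (ℕ.<⇒≤ j<ℓ)))
    ; capped   = capped
    ; full     = full
    }
    where
    eq : ∀ s n m p k → n ≡ m + p - k + (s + (n - m - p + k)) - s
    eq = solve-∀

module FieldRows {n ℓ : ℕ} (Λ : FominField n ℓ) where
  open FominField Λ

  -- Time is the sum of the two coordinates of the cylinder.
  sig : ℤ → ℤ → Signature ℓ
  sig t x = at (x , t - x)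

  private
    at₁ : ∀ t x → at ((x , t - x) ⊕ e₁) ≡ sig (ℤ.suc t) (ℤ.suc x)
    at₁ t x = cong₂ (λ x y → at (x , y)) (ℤ.+-comm x 1ℤ) (eq t x)
      where
      eq : ∀ t x → t - x + 0ℤ ≡ 1ℤ + t - (1ℤ + x)
      eq = solve-∀

    at₂ : ∀ t x → at ((x , t - x) ⊕ e₂) ≡ sig (ℤ.suc t) x
    at₂ t x = cong₂ (λ x y → at (x , y)) (ℤ.+-identityʳ x) (eq t x)
      where
      eq : ∀ t x → t - x + 1ℤ ≡ 1ℤ + t - x
      eq = solve-∀

    at₁₂ : ∀ t x → at ((x , t - x) ⊕ e₁ ⊕ e₂) ≡ sig (ℤ.suc (ℤ.suc t)) (ℤ.suc x)
    at₁₂ t x = cong₂ (λ x y → at (x , y)) (eq₁ x) (eq₂ t x)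
      where
      eq₁ : ∀ x → x + 1ℤ + 0ℤ ≡ 1ℤ + x
      eq₁ = solve-∀
      eq₂ : ∀ t x → t - x + 0ℤ + 1ℤ ≡ 1ℤ + (1ℤ + t) - (1ℤ + x)
      eq₂ = solve-∀

    ⪯₁ : ∀ t x → sig t x ⪯ sig (ℤ.suc t) (ℤ.suc x)
    ⪯₁ t x = subst (sig t x ⪯_) (at₁ t x) (interlacing₁ (x , t - x))

    ⪯₂ : ∀ t x → sig t x ⪯ sig (ℤ.suc t) x
    ⪯₂ t x = subst (sig t x ⪯_) (at₂ t x) (interlacing₂ (x , t - x))

    grown : ∀ t x → IsGrowth (sig t x) (sig (ℤ.suc t) (ℤ.suc x)) (sig (ℤ.suc t) x)
                             (sig (ℤ.suc (ℤ.suc t)) (ℤ.suc x))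
    grown t x = transport (at₁ t x) (at₂ t x) (at₁₂ t x) (growth (x , t - x))
      where
      transport : ∀ {κ μ μ′ ρ ρ′ ν ν′ : Signature ℓ} → μ ≡ μ′ → ρ ≡ ρ′ → ν ≡ ν′ →
                  IsGrowth κ μ ρ ν → IsGrowth κ μ′ ρ′ ν′
      transport refl refl refl g = g

    module Square t x = Carrier {ν = sig (ℤ.suc (ℤ.suc t)) (ℤ.suc x)} (⪯₁ t x) (⪯₂ t x)
      (⪯₂ (ℤ.suc t) (ℤ.suc x)) (⪯₁ (ℤ.suc t) x) (grown t x)

  rows : Rows n ℓ
  rows = record
    { q        = λ t x → nth (entries (sig t x))
    ; C        = Square.C
    ; periodic = λ t x m j → cong (λ v → nth v j)
        (sym (Func.cong field-map (m , refl , eq t x (m * + n))))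
    ; mono₁    = λ t x → nth-≤ (sig t x) (sig (ℤ.suc t) (ℤ.suc x)) (⪯₁ t x)
    ; mono₂    = λ t x → nth-≤ (sig t x) (sig (ℤ.suc t) x) (⪯₂ t x)
    ; face     = Square.growth-law
    }
    where
    eq : ∀ t x m → t - (x + m) ≡ t - x - m
    eq = solve-∀

-- Periods as partitions

nth-ext : ∀ {ℓ} {v w : Vec ℤ ℓ} → (∀ {j} → j ℕ.< ℓ → nth v j ≡ nth w j) → v ≡ w
nth-ext {v = []}    {[]}    _    = refl
nth-ext {v = x ∷ v} {y ∷ w} same = cong₂ _∷_ (same (s≤s z≤n)) (nth-ext λ j<ℓ → same (s≤s j<ℓ))

nth-zipWith : ∀ {ℓ} (f : ℤ → ℤ → ℤ) (v w : Vec ℤ ℓ) {j} → j ℕ.< ℓ →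
              nth (Vec.zipWith f v w) j ≡ f (nth v j) (nth w j)
nth-zipWith f (x ∷ v) (y ∷ w) {zero}  _         = refl
nth-zipWith f (x ∷ v) (y ∷ w) {suc j} (s≤s j<ℓ) = nth-zipWith f v w j<ℓ

nth-∷ʳ : ∀ {ℓ} (v : Vec ℤ ℓ) x {j} → j ℕ.< ℓ → nth (v Vec.∷ʳ x) j ≡ nth v j
nth-∷ʳ (y ∷ v) x {zero}  _         = refl
nth-∷ʳ (y ∷ v) x {suc j} (s≤s j<ℓ) = nth-∷ʳ v x j<ℓ

nth-∷ʳ-last : ∀ {ℓ} (v : Vec ℤ ℓ) x → nth (v Vec.∷ʳ x) ℓ ≡ x
nth-∷ʳ-last []      x = refl
nth-∷ʳ-last (y ∷ v) x = nth-∷ʳ-last v x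

nth-reverse : ∀ {ℓ} (v : Vec ℤ ℓ) {j} → j ℕ.< ℓ → nth (Vec.reverse v) j ≡ nth v (ℓ ℕ.∸ suc j)
nth-reverse {suc ℓ} (x ∷ v) {j} j<1+ℓ = trans (cong (λ w → nth w j) (Vec.reverse-∷ x v)) (go (j ℕ.≟ ℓ))
  where
  go : Dec (j ≡ ℓ) → nth (Vec.reverse v Vec.∷ʳ x) j ≡ nth (x ∷ v) (ℓ ℕ.∸ j)
  go (yes refl) = trans (nth-∷ʳ-last (Vec.reverse v) x) (cong (nth (x ∷ v)) (sym (ℕ.n∸n≡0 ℓ)))
  go (no  j≢ℓ)  = trans (nth-∷ʳ (Vec.reverse v) x j<ℓ)
    (trans (nth-reverse v j<ℓ) (cong (nth (x ∷ v)) (suc-∸-suc j<ℓ)))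
    where j<ℓ = ℕ.≤∧≢⇒< (ℕ.≤-pred j<1+ℓ) j≢ℓ

nth-replicate : ∀ ℓ j → nth (Vec.replicate ℓ 0ℤ) j ≡ 0ℤ
nth-replicate zero    _       = refl
nth-replicate (suc ℓ) zero    = refl
nth-replicate (suc ℓ) (suc j) = nth-replicate ℓ j

-- The sequence is cut at its first zero, after which monotonicity leaves only zeros.
partition : ∀ ℓ (w : ℕ → ℕ) → (∀ {j} → suc j ℕ.< ℓ → w (suc j) ℕ.≤ w j) →
  Σ[ ℓ′ ∈ ℕ ] Σ[ ℓ′≤ℓ ∈ ℓ′ ℕ.≤ ℓ ] Σ[ μ ∈ Partition ℓ′ ]
    (∀ {j} → j ℕ.< ℓ → nth (padded ℓ′≤ℓ μ) j ≡ + w j)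
partition zero    w w↓ = 0 , z≤n , record { parts = [] ; decreasing = [] ; positive = [] } , λ ()
partition (suc ℓ) w w↓ with w 0 in w0 | partition ℓ (λ j → w (suc j)) (λ j<ℓ → w↓ (s≤s j<ℓ))
... | zero  | _ = 0 , z≤n , record { parts = [] ; decreasing = [] ; positive = [] } ,
  λ {j} j<ℓ → trans (nth-replicate (suc ℓ) j) (cong +_ (sym (vanishes j j<ℓ)))
  where
  vanishes : ∀ j → j ℕ.< suc ℓ → w j ≡ 0
  vanishes zero    _   = w0
  vanishes (suc j) j<ℓ = ℕ.n≤0⇒n≡0 (subst (w (suc j) ℕ.≤_) (vanishes j (ℕ.<⇒≤ j<ℓ)) (w↓ j<ℓ))
... | suc a | ℓ′ , ℓ′≤ℓ , record { parts = ps ; decreasing = d ; positive = p } , same =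
  suc ℓ′ , s≤s ℓ′≤ℓ , record { parts = suc a ∷ ps ; decreasing = extend ps ℓ′≤ℓ d p same ; positive = s≤s z≤n ∷ p } ,
  λ { {zero} _ → cong +_ (sym w0) ; {suc j} (s≤s j<ℓ) → same j<ℓ }
  where
  extend : ∀ {ℓ′} (ps : Vec ℕ ℓ′) (ℓ′≤ℓ : ℓ′ ℕ.≤ ℓ) (d : Linked ℕ._≥_ ps) p →
           (∀ {j} → j ℕ.< ℓ → nth (padded ℓ′≤ℓ (record { parts = ps ; decreasing = d ; positive = p })) j ≡ + w (suc j)) →
           Linked ℕ._≥_ (suc a ∷ ps)
  extend []       _          _ _ _    = [-]
  extend (b ∷ ps) (s≤s ℓ′≤ℓ) d _ same =
    subst (ℕ._≤ suc a) (sym (ℤ.+-injective (same (s≤s z≤n)))) (subst (w 1 ℕ.≤_) w0 (w↓ (s≤s (s≤s z≤n)))) ∷ d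

-- Reading the settled regimes back on the cylinder.

module Assemble {n′ ℓ : ℕ} (Λ : FominField (suc n′) ℓ) where
  private
    n = suc n′
    F = FieldRows.rows Λ
  open FominField Λ
  open RowsProperties F

  entry : ∀ x y t → x + y ≡ t → ∀ j → nth (entries (at (x , y))) j ≡ q t x j
  entry x y _ refl j = cong (λ z → nth (entries (at (x , z))) j) (eq x y)
    where
    eq : ∀ x y → y ≡ x + y - x
    eq = solve-∀

  module Shape {T T⁻ v u} (S : Settled F T v) (S⁻ : Settled (reverse F) T⁻ u) where

    -- Speeds are nonnegative because rows never shrink in time, so they can serve as parts.
    ∣v∣ : ∀ {j} → j ℕ.< ℓ → + ∣ v j ∣ ≡ v j
    ∣v∣ j<ℓ = ℤ.0≤i⇒+∣i∣≡i (subst (0ℤ ≤_) (Settled.steady S ℤ.≤-refl 0ℤ j<ℓ) (diff (mono₂▹ T 0ℤ n j<ℓ)))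

    ∣v∣-antitone : ∀ {j} → suc j ℕ.< ℓ → ∣ v (suc j) ∣ ℕ.≤ ∣ v j ∣
    ∣v∣-antitone j<ℓ = ℤ.drop‿+≤+
      (subst₂ _≤_ (sym (∣v∣ j<ℓ)) (sym (∣v∣ (ℕ.<⇒≤ j<ℓ))) (Settled.v-antitone S j<ℓ))

    t* : ℤ
    -- `∣ T ∣` serves the future. The past needs `∣ T⁻ ∣ + n`, because the second coordinate `i ≤ n`
    -- brings the point up to `n` steps closer to time zero. The `suc` makes the bound positive.
    t* = + suc (∣ T ∣ ℕ.+ (∣ T⁻ ∣ ℕ.+ n))

    module Period (p : Vec ℤ ℓ) (p-entries : ∀ {j} → j ℕ.< ℓ → nth p j ≡ + ∣ v j ∣) where

      T≤t* : T ≤ t*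
      T≤t* = ℤ.≤-trans (i≤+∣i∣ T) (ℤ.+≤+ (ℕ.m≤n⇒m≤1+n (ℕ.m≤m+n ∣ T ∣ _)))

      T⁻+n≤t* : T⁻ + + n ≤ t*
      T⁻+n≤t* = ℤ.≤-trans (ℤ.+-monoˡ-≤ (+ n) (i≤+∣i∣ T⁻)) (ℤ.+≤+ (ℕ.m≤n⇒m≤1+n (ℕ.m≤n+m _ ∣ T ∣)))

      p-speed : ∀ {j} → j ℕ.< ℓ → nth p j ≡ v j
      p-speed j<ℓ = trans (p-entries j<ℓ) (∣v∣ j<ℓ)

      forward : ∀ t → t* ≤ t → ∀ i → entries (at (t + + n , + i)) ≡ entries (at (t , + i)) +ᵛ p
      forward t t*≤t i = nth-ext λ {j} j<ℓ → trans (entry (t + + n) (+ i) (s ▹ n) time j)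
        -- Adding `n` to the first coordinate advances both time and position by `n`; periodicity
        -- takes the position back, leaving one period of time.
        (trans (cong (λ x → q (s ▹ n) x j) (sym (▹-+ t n)))
        (trans (periodic▹ (s ▹ n) t j)
        (trans (eq (q (s ▹ n) t j) (q s t j))
        (trans (cong₂ _+_ (sym (entry t (+ i) s refl j))
          (trans (Settled.steady S T≤s t j<ℓ) (sym (p-speed j<ℓ))))
        (sym (nth-zipWith _+_ (entries (at (t , + i))) p j<ℓ))))))
        where
        s = t + + i
        eq : ∀ a b → a ≡ b + (a - b)
        eq = solve-∀
        time : t + + n + + i ≡ s ▹ n
        time = trans (eq′ t (+ n) (+ i)) (sym (▹-+ s n))
          where
          eq′ : ∀ t n i → t + n + i ≡ t + i + n
          eq′ = solve-∀
        T≤s : T ≤ s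
        T≤s = ℤ.≤-trans (ℤ.≤-trans T≤t* t*≤t) (ℤ.i≤i+j t (+ i))

      backward : ∀ t → t* ≤ t → ∀ i → i ℕ.≤ n →
        entries (at (- t - + n , + i)) ≡ entries (at (- t , + i)) -ᵛ Vec.reverse p
      backward t t*≤t i i≤n = nth-ext λ {j} j<ℓ → trans (entry (- t - + n) (+ i) s refl j)
        (trans (sym (periodic▹ s (- t - + n) j))
        (trans (cong (λ x → q s x j) x-turn)
        (trans (eq (q s (- t) j) (q (s ▹ n) (- t) j))
        (trans (cong₂ _-_ (sym (entry (- t) (+ i) (s ▹ n) time j)) (rise j<ℓ))
        (sym (nth-zipWith _-_ (entries (at (- t , + i))) (Vec.reverse p) j<ℓ))))))
        where
        s = - t - + n + + i
        eq : ∀ a b → a ≡ b - (b - a)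
        eq = solve-∀
        x-turn : (- t - + n) ▹ n ≡ - t
        x-turn = trans (▹-+ (- t - + n) n) (eq′ (- t) (+ n))
          where
          eq′ : ∀ t n → t - n + n ≡ t
          eq′ = solve-∀
        time : - t + + i ≡ s ▹ n
        time = trans (eq′ (- t) (+ n) (+ i)) (sym (▹-+ s n))
          where
          eq′ : ∀ t n i → t + i ≡ t - n + i + n
          eq′ = solve-∀
        T⁻≤ : T⁻ ≤ - (s ▹ n)
        T⁻≤ = by-difference (diff (ℤ.≤-trans T⁻+n≤t* t*≤t) ⊞ diff (ℤ.+≤+ i≤n))
          (trans (cong (λ s → - s - T⁻) (sym time)) (eq′ t (+ i) (+ n) T⁻))
          where
          eq′ : ∀ t i n T → - (- t + i) - T ≡ t - (T + n) + (n - i)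
          eq′ = solve-∀
        rise : ∀ {j} → j ℕ.< ℓ → speed s (- t) j ≡ nth (Vec.reverse p) j
        rise {j} j<ℓ = trans (cong (speed s (- t)) (sym (mirror-index j<ℓ)))
          (trans (sym (reverse-speed F s (- t)))
          (trans (Settled.steady S⁻ T⁻≤ (- - t) (∸-suc-< j<ℓ))
          (trans (sym (speeds-agree F S S⁻ (∸-suc-< j<ℓ)))
          (trans (sym (p-speed (∸-suc-< j<ℓ))) (sym (nth-reverse p j<ℓ))))))

theorem1p3 : ∀ (n ℓ : ℕ) → 1 ℕ.≤ n → (Λ : FominField n ℓ) →
    let open FominField Λ in
    Σ[ ℓ′ ∈ ℕ ] Σ[ ℓ′≤ℓ ∈ ℓ′ ℕ.≤ ℓ ] Σ[ μ ∈ Partition ℓ′ ] Σ[ t* ∈ ℤ ]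
    (0ℤ < t*) ×
    (∀ (t : ℤ) → t* ≤ t → ∀ (i : ℕ) → i ℕ.≤ n →
    (entries (at (t + + n , + i))
    ≡ entries (at (t , + i)) +ᵛ padded ℓ′≤ℓ μ)
    ×
    (entries (at (- t - + n , + i))
    ≡ entries (at (- t , + i)) -ᵛ paddedReversed ℓ′≤ℓ μ))
theorem1p3 (suc n′) ℓ (s≤s z≤n) Λ =
  let F = FieldRows.rows Λ
      T , v , S   = Future.settles F
      T⁻ , u , S⁻ = Future.settles (reverse F)
      open Assemble.Shape Λ S S⁻
      ℓ′ , ℓ′≤ℓ , μ , μ-entries = partition ℓ (λ j → ∣ v j ∣) ∣v∣-antitone
      open Period (padded ℓ′≤ℓ μ) μ-entries
  in ℓ′ , ℓ′≤ℓ , μ , t* , ℤ.+<+ (s≤s z≤n) ,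
     λ t t*≤t i i≤n → forward t t*≤t i , backward t t*≤t i i≤n
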